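{- There is an encoding $\overline{\,\cdot\,}$ of log-sensitive Turing machines (and of binary strings) into the deterministic $\lambda$-calculus $\Lambda_{\mathtt{det}}$ such that, for every log-sensitive Turing machine $M$ and every input $i\in\{0,1\}^*$, if the run $\rho$ of $M$ on input $i$: 1. (Termination) ends in the final state $q_b$ with $b\in\{0,1\}$, then there is a complete sequence $\sigma:\overline{M}\,\overline{i}\to_{det}^{n}\overline{q_b}$ where $n=\Theta\big((T_{\mathrm{TM}}(\rho)+1)\cdot|i|\cdot\log|i|\big)$; 2. (Divergence) diverges, then $\overline{M}\,\overline{i}$ is $\to_{det}$-divergent; 3. (Space KAM) the space used by the Space KAM to simulate the evaluation of point 1 is $O\big(S_{\mathrm{TM}}(\rho)+\log|i|\big)$.
   Context: **$\lambda$-terms.** $t,u::=x\mid\lambda x.t\mid t\,u$, up to $\alpha$-equivalence; $|t|$ is the number of constructors. **Deterministic $\lambda$-calculus $\Lambda_{\mathtt{det}}$.** The fragment of $\lambda$-terms in which the right sub-term of every application is a variable or an abstraction: terms $t::=v\mid t\,v$, values $v::=\lambda x.t\mid x$. Its reduction is $(\lambda x.t)\,v\,v_1\cdots v_h\to_{det} t\{x{\leftarrow}v\}\,v_1\cdots v_h$ ($h\ge0$), which on closed terms coincides with weak head reduction. A sequence is complete if it ends on a normal term. **Log-sensitive TMs.** Deterministic TMs with a read-only input tape over $\{0,1,\mathsf L,\mathsf R\}$ holding the binary input $i$ delimited by $\mathsf L$ and $\mathsf R$, one read-write work tape over $\{0,1,\Box\}$ (initially blank), no output tape, and two final states $q_0,q_1$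 giving a boolean output. For a run $\rho$: $T_{\mathrm{TM}}(\rho)$ is its number of transitions; $S_{\mathrm{TM}}(\rho)$ is the maximum number of work tape cells used. Asymptotic constants may depend on $M$ but not on $i$. **Encodings of data.** Binary strings are Scott-encoded: $\overline{\varepsilon}=\lambda x_0.\lambda x_1.\lambda x_\varepsilon.x_\varepsilon$ and $\overline{b\cdot r}=\lambda x_0.\lambda x_1.\lambda x_\varepsilon.x_b\,\overline r$ for $b\in\{0,1\}$. The two outputs are encoded by the two boolean terms $\overline{q_1}=\lambda x.\lambda y.x$ (accept) and $\overline{q_0}=\lambda x.\lambda y.y$ (reject). **Space KAM.** Environments $e::=\epsilon\mid[x{\leftarrow}c]\cdot e$, closures $c=(t,e)$, stacks $\pi::=\epsilon\mid c\cdot\pi$; states are triples $(t,e,\pi)$, together with an immutable closed code $t_0$. $e(x)$ is the closure associated to $x$ in $e$; $e|_t$ is the restriction of $e$ to the free variables $\mathsf{fv}(t)$ of $t$. The initial state for closed $t_0$ has code $t_0$ and is $(t_0,\epsilon,\epsilon)$. Transitions: - $(t\,x,e,\pi)\to(t,e|_t,e(x)\cdot\pi)$; - $(t\,u,e,\pi)\to(t,e|_t,(u,e|_u)\cdot\pi)$ if $u$ is not a variable; - $(\lambda x.t,e,c\cdot\pi)\to(t,e,\pi)$ if $x\notin\mathsf{fv}(t)$; - $(\lambda x.t,e,c\cdot\pi)\to(t,[x{\leftarrow}c]\cdot e,\pi)$ if $x\in\mathsf{fv}(t)$; - $(x,e,\pi)\to(u,e',\pi)$ if $e(x)=(u,e')$.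 Space: every term $u$ in a reachable state is a sub-term (occurrence) of the code $t_0$ and is represented by its left address, i.e. the index written in binary of its root constructor in the in-order enumeration of the constructors of $t_0$ (for an application: constructors of the left sub-term, then the application, then those of the right sub-term; for an abstraction: the abstraction, then the constructors of the body). A term occurrence costs the bit-length of its left address (the variable of an environment entry is a pointer to its binder in the code, costed likewise); environments, closures and stacks are flat strings with no pointers linking them, so the space of a state is the sum of the costs of its components (the code is not counted). The space of a run is the maximum of the space of its states. The Space KAM simulates $\sigma$ by its run from the initial state for $\overline M\,\overline i$.
   Formalization: The bound n = Θ((T_TM(ρ)+1)·|i|·log|i|) is stated for |i| ≥ 2 only: for |i| = 1 the right-hand side is 0 although n ≥ 1, and for |i| = 0 the logarithm is undefined; all other claims cover every i. -}

module Defs where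

open import Data.Bool using (Bool; true; false)
open import Data.Fin using (Fin; zero; suc; toℕ)
open import Data.Fin.Subset using (Subset; inside; outside; _∈_; _∉_; ⁅_⁆; _∪_)
open import Data.Fin.Substitution using (Sub; Lift; TermSubst)
open import Data.List using (List; []; _∷_; length; map)
open import Data.Maybe using (Maybe; just; nothing)
open import Data.Nat using (ℕ; zero; suc; _+_; _*_; _⊔_; _≤_)
open import Data.Nat.ListAction using (sum)
open import Data.Nat.Logarithm using (⌊log₂_⌋)
open import Data.Product using (_×_; _,_; ∃-syntax)
open import Data.Vec using (Vec; lookup; fromList; tail; _∷ʳ_)
import Data.Vec as Vec
open import Function using (flip)
open import Induction.InfiniteDescent using (InfiniteDescendingSequenceFrom)
open import Relation.Binary.Construct.Closure.ReflexiveTransitive using (Star; ε; _◅_)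
open import Relation.Binary.PropositionalEquality using (_≡_; _≢_)
open import Relation.Nullary using (¬_)

module _ {A : Set} {_⟶_ : A → A → Set} where

  steps : ∀ {x y} → Star _⟶_ x y → ℕ
  steps ε       = 0
  steps (_ ◅ ρ) = suc (steps ρ)

  -- Maximum of f over all the states of the run, both ends included.
  peak : (A → ℕ) → ∀ {x y} → Star _⟶_ x y → ℕ
  peak f {x} ε       = f x
  peak f {x} (_ ◅ ρ) = f x ⊔ peak f ρ

Diverges : {A : Set} (_⟶_ : A → A → Set) → A → Set
Diverges _⟶_ x = ∃[ f ] InfiniteDescendingSequenceFrom (flip _⟶_) f x

-- m = O(n) with constant c.
infix 4 _≤O[_]_ _≈Θ[_]_

_≤O[_]_ : ℕ → ℕ → ℕ → Set
m ≤O[ c ] n = m ≤ c * n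

-- m = Θ(n) with constants 1/c and c.
_≈Θ[_]_ : ℕ → ℕ → ℕ → Set
m ≈Θ[ c ] n = m ≤O[ c ] n × n ≤O[ c ] m

infixl 9 _·_

-- Terms up to α-equivalence, with free variables in Fin n.
data Term (n : ℕ) : Set where
  var : (x : Fin n) → Term n
  ƛ   : (t : Term (suc n)) → Term n
  _·_ : (t u : Term n) → Term n

∣_∣ : ∀ {n} → Term n → ℕ
∣ var x ∣ = 1
∣ ƛ t ∣   = suc ∣ t ∣
∣ t · u ∣ = ∣ t ∣ + suc ∣ u ∣

fv : ∀ {n} → Term n → Subset n
fv (var x) = ⁅ x ⁆
fv (ƛ t)   = tail (fv t)
fv (t · u) = fv t ∪ fv u

module TermApp {T : ℕ → Set} (l : Lift T Term) where
  open Lift l hiding (var)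

  infixl 8 _/_

  _/_ : ∀ {m n} → Term m → Sub T m n → Term n
  var x / ρ   = lift (lookup ρ x)
  ƛ t / ρ     = ƛ (t / ρ ↑)
  (t · u) / ρ = (t / ρ) · (u / ρ)

termSubst : TermSubst Term
termSubst = record { var = var ; app = TermApp._/_ }

open TermSubst termSubst using (_/_; sub)

infix 8 _[_]

_[_] : ∀ {n} → Term (suc n) → Term n → Term n
t [ u ] = t / sub u

data IsVar {n} : Term n → Set where
  var : ∀ x → IsVar (var x)

data IsValue {n} : Term n → Set where
  var : ∀ x → IsValue (var x)
  ƛ   : ∀ t → IsValue (ƛ t)

data Det {n} : Term n → Set where
  var : ∀ x → Det (var x)
  ƛ   : ∀ {t} → Det t → Det (ƛ t)
  app : ∀ {t v} → Det t → Det v → IsValue v → Det (t · v)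

infix 4 _→det_

-- On terms of the fragment Det, this is the reduction of Λ_det. The rule
-- argʳ adds the further arguments v₁ ⋯ v_h one at a time.
data _→det_ {n} : Term n → Term n → Set where
  β    : ∀ {t v} → IsValue v → ƛ t · v →det t [ v ]
  argʳ : ∀ {t t′ v} → t →det t′ → IsValue v → t · v →det t′ · v

-- The binders of a string are, outermost first, x₀, x₁ and x_ε, hence
-- the indices 2, 1 and 0. The result is closed, so it can be typed in
-- any scope n.
⌈_⌉ : ∀ {n} → List Bool → Term n
⌈ [] ⌉        = ƛ (ƛ (ƛ (var zero)))
⌈ false ∷ r ⌉ = ƛ (ƛ (ƛ (var (suc (suc zero)) · ⌈ r ⌉)))
⌈ true ∷ r ⌉  = ƛ (ƛ (ƛ (var (suc zero) · ⌈ r ⌉)))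

⌈_⌉ᵇ : Bool → Term 0
⌈ true ⌉ᵇ  = ƛ (ƛ (var (suc zero)))
⌈ false ⌉ᵇ = ƛ (ƛ (var zero))

⌈⌉-isValue : ∀ {n} i → IsValue {n} ⌈ i ⌉
⌈⌉-isValue []          = ƛ _
⌈⌉-isValue (false ∷ _) = ƛ _
⌈⌉-isValue (true ∷ _)  = ƛ _

⌈⌉-det : ∀ {n} i → Det {n} ⌈ i ⌉
⌈⌉-det []          = ƛ (ƛ (ƛ (var _)))
⌈⌉-det (false ∷ r) = ƛ (ƛ (ƛ (app (var _) (⌈⌉-det r) (⌈⌉-isValue r))))
⌈⌉-det (true ∷ r)  = ƛ (ƛ (ƛ (app (var _) (⌈⌉-det r) (⌈⌉-isValue r))))

⌈⌉ᵇ-det : ∀ b → Det ⌈ b ⌉ᵇ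
⌈⌉ᵇ-det true  = ƛ (ƛ (var _))
⌈⌉ᵇ-det false = ƛ (ƛ (var _))

data InputSym : Set where
  bit : Bool → InputSym
  L R : InputSym

data WorkSym : Set where
  bit : Bool → WorkSym
  □   : WorkSym

data Move : Set where
  left stay right : Move

record TM : Set where
  field
    states : ℕ
    start  : Fin states
    final  : Bool → Fin states      -- q₀ is final false, q₁ is final true
    q₀≢q₁  : final false ≢ final true
    -- Symbol written, input head move, work head move, next state.
    δ      : Fin states → InputSym → WorkSym →
             Maybe (WorkSym × Move × Move × Fin states)
    halts  : ∀ b s a → δ (final b) s a ≡ nothing

-- The two-way infinite work tape, as a zipper of the cells visited so
-- far; ls is the part to the left of the head, nearest cell first.
record WorkTape : Set where
  constructor tape
  field
    ls   : List WorkSym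
    head : WorkSym
    rs   : List WorkSym

write : WorkSym → WorkTape → WorkTape
write a (tape ls _ rs) = tape ls a rs

moveWork : Move → WorkTape → WorkTape
moveWork left  (tape []       a rs)       = tape [] □ (a ∷ rs)
moveWork left  (tape (l ∷ ls) a rs)       = tape ls l (a ∷ rs)
moveWork stay  w                          = w
moveWork right (tape ls       a [])       = tape (a ∷ ls) □ []
moveWork right (tape ls       a (r ∷ rs)) = tape (a ∷ ls) r rs

inputTape : (i : List Bool) → Vec InputSym (2 + length i)
inputTape i = L Vec.∷ (Vec.map bit (fromList i) ∷ʳ R)

-- Undefined when the head would leave the delimited input.
data MoveInput {n} : Move → Fin n → Fin n → Set where
  left  : ∀ {p p′} → toℕ p ≡ suc (toℕ p′) → MoveInput left p p′
  stay  : ∀ {p} → MoveInput stay p p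
  right : ∀ {p p′} → toℕ p′ ≡ suc (toℕ p) → MoveInput right p p′

module _ (M : TM) (i : List Bool) where
  open TM M

  record Config : Set where
    constructor config
    field
      state : Fin states
      pos   : Fin (2 + length i)
      work  : WorkTape

  initial : Config
  initial = config start zero (tape [] □ [])

  data _⟶TM_ : Config → Config → Set where
    step : ∀ {q p p′ w a mi mw q′} →
           δ q (lookup (inputTape i) p) (WorkTape.head w) ≡ just (a , mi , mw , q′) →
           MoveInput mi p p′ →
           config q p w ⟶TM config q′ p′ (moveWork mw (write a w))

Run : (M : TM) (i : List Bool) → Config M i → Set
Run M i = Star (_⟶TM_ M i) (initial M i)

module _ {M : TM} {i : List Bool} where

  cells : Config M i → ℕ
  cells (config _ _ (tape ls _ rs)) = length ls + 1 + length rs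

  T-TM : ∀ {C} → Run M i C → ℕ
  T-TM = steps

  S-TM : ∀ {C} → Run M i C → ℕ
  S-TM = peak cells

-- A term occurrence in the code is a pair of the term and the index of
-- the first of its constructors in the in-order enumeration of the
-- constructors of the code, which starts from 1. Its root has this index
-- unless the term is an application.
address : ∀ {n} → ℕ → Term n → ℕ
address o (var x) = o
address o (ƛ t)   = o
address o (t · u) = o + ∣ t ∣

bits : ℕ → ℕ
bits k = suc ⌊log₂ k ⌋

infixr 5 _↦_∷_ ∙∷_

-- An environment for a term in scope n lists at most one entry per
-- variable in scope. The entry a ↦ c binds the variable whose binder has
-- address a; ∙ marks a variable with no entry and is not stored.
mutual
  data Env : ℕ → Set where
    ∅     : Env 0
    _↦_∷_ : ∀ {n} → ℕ → Closure → Env n → Env (suc n)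
    ∙∷_   : ∀ {n} → Env n → Env (suc n)

  data Closure : Set where
    clo : ∀ {n} → ℕ → Term n → Env n → Closure

_⟨_⟩ : ∀ {n} → Env n → Fin n → Maybe Closure
(_ ↦ c ∷ e) ⟨ zero ⟩  = just c
(_ ↦ c ∷ e) ⟨ suc x ⟩ = e ⟨ x ⟩
(∙∷ e) ⟨ zero ⟩       = nothing
(∙∷ e) ⟨ suc x ⟩      = e ⟨ x ⟩

restrict : ∀ {n} → Env n → Subset n → Env n
restrict ∅           _                   = ∅
restrict (a ↦ c ∷ e) (inside Vec.∷ xs)  = a ↦ c ∷ restrict e xs
restrict (a ↦ c ∷ e) (outside Vec.∷ xs) = ∙∷ restrict e xs
restrict (∙∷ e)      (_ Vec.∷ xs)       = ∙∷ restrict e xs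

infixl 10 _↾_

_↾_ : ∀ {n} → Env n → Term n → Env n
e ↾ t = restrict e (fv t)

Stack : Set
Stack = List Closure

-- The first two components are the current term occurrence.
data State : Set where
  ⟪_,_,_,_⟫ : ∀ {n} → ℕ → Term n → Env n → Stack → State

load : Term 0 → State
load t₀ = ⟪ 1 , t₀ , ∅ , [] ⟫

infix 4 _→KAM_

data _→KAM_ : State → State → Set where
  app-var  : ∀ {n o t x π c} {e : Env n} → e ⟨ x ⟩ ≡ just c →
             ⟪ o , t · var x , e , π ⟫ →KAM ⟪ o , t , e ↾ t , c ∷ π ⟫
  app      : ∀ {n o t u π} {e : Env n} → ¬ IsVar u →
             ⟪ o , t · u , e , π ⟫ →KAM
             ⟪ o , t , e ↾ t , clo (suc (o + ∣ t ∣)) u (e ↾ u) ∷ π ⟫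
  lam-drop : ∀ {n o t c π} {e : Env n} → zero ∉ fv t →
             ⟪ o , ƛ t , e , c ∷ π ⟫ →KAM ⟪ suc o , t , ∙∷ e , π ⟫
  lam-bind : ∀ {n o t c π} {e : Env n} → zero ∈ fv t →
             ⟪ o , ƛ t , e , c ∷ π ⟫ →KAM ⟪ suc o , t , o ↦ c ∷ e , π ⟫
  var      : ∀ {m n o o′ u x π} {e : Env m} {e′ : Env n} →
             e ⟨ x ⟩ ≡ just (clo o′ u e′) →
             ⟪ o , var x , e , π ⟫ →KAM ⟪ o′ , u , e′ , π ⟫

mutual
  costEnv : ∀ {n} → Env n → ℕ
  costEnv ∅           = 0
  costEnv (a ↦ c ∷ e) = bits a + costClosure c + costEnv e
  costEnv (∙∷ e)      = costEnv e

  costClosure : Closure → ℕ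
  costClosure (clo o t e) = bits (address o t) + costEnv e

space : State → ℕ
space ⟪ o , t , e , π ⟫ =
  bits (address o t) + costEnv e + sum (map costClosure π)

S-KAM : ∀ {s s′} → Star _→KAM_ s s′ → ℕ
S-KAM = peak space

{-# OPTIONS --safe #-}
-- The position on the input is a pointer to a suffix of the string i. Walking
-- along two suffixes a and p until p is exhausted yields drop ∣p∣ a; from i
-- and the suffix at position k this is a suffix of length k, so that a move to
-- the left is a walk, a tail and a second walk. No counter is needed. The same
-- walk maps the suffix at offset d to the one at 2d + 1 in n = |i| iterations,
-- and repeating it from d = 0 until the suffix is empty takes ⌊log₂ n⌋ + 1
-- rounds: this is run before every transition, to spend time Θ(n log n).
--
-- The machine comes before the input in the code, so its addresses have
-- constant length and only the boundedly many pointers into i cost O(log n).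
-- One transition of the KAM at most doubles the size of its state. Hence the
-- space bound is needed only at the start of the simulation of each transition
-- and along the walks, whose states all have the same size: what lies between
-- is a bounded number of transitions, found by evaluation.
module Submission where

open import Defs
open import Data.Bool using (Bool; true; false; T; _∨_; _∧_; if_then_else_)
open import Data.Empty using (⊥-elim)
open import Data.Fin using (Fin; zero; suc; toℕ; fromℕ<; _≟_)
open import Data.Fin.Properties using (toℕ-fromℕ<; toℕ<n)
open import Data.Fin.Subset using (Subset; inside; outside; _∈_; _∉_; ⁅_⁆; _∪_; ⊥)
open import Data.Fin.Substitution using (Sub; Subs; Lift; TermSubst)
open import Data.Fin.Substitution.Lemmas using (TermLemmas)
open import Data.List using (List; []; _∷_; length; map; drop; replicate)
open import Data.List.Properties using (length-drop; drop-drop; drop-all)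
open import Data.List.Relation.Binary.Pointwise using (Pointwise; []; _∷_)
open import Data.Maybe using (Maybe; just; nothing; _>>=_)
import Data.Maybe as Maybe
open import Data.Nat
  using (ℕ; zero; suc; _+_; _*_; _^_; _∸_; _≤_; _<_; _≥_; _<ᵇ_; z≤n; s≤s; ⌊_/2⌋; ⌈_/2⌉)
open import Data.Nat.Induction using (<-rec)
open import Data.Nat.ListAction using (sum)
open import Data.Nat.Logarithm
  using (⌊log₂_⌋; ⌊log₂⌋-mono-≤; ⌊log₂⌊n/2⌋⌋≡⌊log₂n⌋∸1; ⌊log₂[2^n]⌋≡n)
open import Data.Nat.Properties hiding (_≟_)
open import Data.Nat.Tactic.RingSolver using (solve-∀)
open import Data.Product using (_×_; _,_; proj₁; proj₂; ∃; ∃-syntax)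
open import Data.Vec using (Vec; lookup; tail; here)
import Data.Vec as Vec
import Data.Vec.Properties as Vec
open import Function using (_∘_)
open import Relation.Binary.Construct.Closure.ReflexiveTransitive using (Star; ε; _◅_; _◅◅_)
open import Relation.Binary.PropositionalEquality
  using (_≡_; refl; sym; trans; cong; cong₂; subst; subst₂)
open import Relation.Binary.Rewriting using (IsNormalForm)
open import Relation.Nullary using (does; ¬_)
open import Relation.Nullary.Decidable using (dec-true; dec-false)

-- Substitution and decoding

open TermSubst termSubst using (_/_; sub; _⊙_; weaken; _↑)

ƛ-/✶-↑✶ : ∀ {T} (l : Lift T Term) → let open TermSubst.Lifted termSubst l using (_↑✶_; _/✶_) in
           ∀ k {m n t} (ρs : Subs T m n) → ƛ t /✶ ρs ↑✶ k ≡ ƛ (t /✶ ρs ↑✶ suc k)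
ƛ-/✶-↑✶ l k ε        = refl
ƛ-/✶-↑✶ l k (ρ ◅ ρs) = cong₂ (TermApp._/_ l) (ƛ-/✶-↑✶ l k ρs) refl

·-/✶-↑✶ : ∀ {T} (l : Lift T Term) → let open TermSubst.Lifted termSubst l using (_↑✶_; _/✶_) in
           ∀ k {m n t u} (ρs : Subs T m n) →
           (t · u) /✶ ρs ↑✶ k ≡ (t /✶ ρs ↑✶ k) · (u /✶ ρs ↑✶ k)
·-/✶-↑✶ l k ε        = refl
·-/✶-↑✶ l k (ρ ◅ ρs) = cong₂ (TermApp._/_ l) (·-/✶-↑✶ l k ρs) refl

/✶-↑✶-cong : ∀ {T₁ T₂} {l₁ : Lift T₁ Term} {l₂ : Lift T₂ Term} →
             let open TermSubst.Lifted termSubst l₁ using () renaming (_↑✶_ to _↑✶₁_; _/✶_ to _/✶₁_)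
                 open TermSubst.Lifted termSubst l₂ using () renaming (_↑✶_ to _↑✶₂_; _/✶_ to _/✶₂_)
             in
             ∀ {m n} (ρs₁ : Subs T₁ m n) (ρs₂ : Subs T₂ m n) →
             (∀ k x → var x /✶₁ ρs₁ ↑✶₁ k ≡ var x /✶₂ ρs₂ ↑✶₂ k) →
             ∀ k t → t /✶₁ ρs₁ ↑✶₁ k ≡ t /✶₂ ρs₂ ↑✶₂ k
/✶-↑✶-cong ρs₁ ρs₂ hyp k (var x) = hyp k x
/✶-↑✶-cong {l₁ = l₁} {l₂} ρs₁ ρs₂ hyp k (ƛ t) =
  trans (ƛ-/✶-↑✶ l₁ k ρs₁)
    (trans (cong ƛ (/✶-↑✶-cong ρs₁ ρs₂ hyp (suc k) t)) (sym (ƛ-/✶-↑✶ l₂ k ρs₂)))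
/✶-↑✶-cong {l₁ = l₁} {l₂} ρs₁ ρs₂ hyp k (t · u) =
  trans (·-/✶-↑✶ l₁ k ρs₁)
    (trans (cong₂ _·_ (/✶-↑✶-cong ρs₁ ρs₂ hyp k t) (/✶-↑✶-cong ρs₁ ρs₂ hyp k u))
           (sym (·-/✶-↑✶ l₂ k ρs₂)))

termLemmas : TermLemmas Term
termLemmas = record { termSubst = termSubst ; app-var = refl ; /✶-↑✶ = /✶-↑✶-cong }

open TermLemmas termLemmas using (/-⊙; weaken-sub; id-vanishes)

↑-⊙-sub : ∀ {m n} (ρ : Sub Term m n) (v : Term n) → ρ ↑ ⊙ sub v ≡ v Vec.∷ ρ
↑-⊙-sub ρ v = cong (v Vec.∷_) (go ρ)
  where
  go : ∀ {m} (ρ : Sub Term m _) → Vec.map (_/ sub v) (Vec.map weaken ρ) ≡ ρ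
  go Vec.[]      = refl
  go (t Vec.∷ ρ) = cong₂ Vec._∷_ (weaken-sub t) (go ρ)

-- Environments are delayed substitutions: contracting a redex after substituting `ρ` amounts to
-- extending `ρ`, which is what the machine does when it binds an argument.
β-/ : ∀ {m n} (t : Term (suc m)) (ρ : Sub Term m n) (v : Term n) →
      (t / ρ ↑) [ v ] ≡ t / (v Vec.∷ ρ)
β-/ t ρ v = trans (sym (/-⊙ t)) (cong (t /_) (↑-⊙-sub ρ v))

∈-∪ˡ : ∀ {n} (p q : Subset n) x → lookup p x ≡ inside → lookup (p ∪ q) x ≡ inside
∈-∪ˡ p q x eq = trans (Vec.lookup-zipWith _∨_ x p q) (cong (_∨ lookup q x) eq)

∈-∪ʳ : ∀ {n} (p q : Subset n) x → lookup q x ≡ inside → lookup (p ∪ q) x ≡ inside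
∈-∪ʳ p q x eq with lookup p x | Vec.lookup-zipWith _∨_ x p q
... | true  | eq′ = eq′
... | false | eq′ = trans eq′ eq

lookup-⁅⁆ : ∀ {n} (x : Fin n) → lookup ⁅ x ⁆ x ≡ inside
lookup-⁅⁆ zero    = refl
lookup-⁅⁆ (suc x) = lookup-⁅⁆ x

lookup-tail : ∀ {n} {A : Set} (v : Vec A (suc n)) x → lookup (tail v) x ≡ lookup v (suc x)
lookup-tail (_ Vec.∷ _) x = refl

-- Because only free variables matter, neither restricting an environment nor dropping an argument
-- changes the decoded term.
/-cong : ∀ {m n} (t : Term m) {ρ σ : Sub Term m n} →
         (∀ x → lookup (fv t) x ≡ inside → lookup ρ x ≡ lookup σ x) → t / ρ ≡ t / σ
/-cong (var x) eq = eq x (lookup-⁅⁆ x)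
/-cong (ƛ t) {ρ} {σ} eq = cong ƛ (/-cong t λ where
  zero    _ → refl
  (suc x) i → trans (Vec.lookup-map x weaken ρ)
    (trans (cong weaken (eq x (trans (lookup-tail (fv t) x) i)))
           (sym (Vec.lookup-map x weaken σ))))
/-cong (t · u) eq = cong₂ _·_
  (/-cong t λ x i → eq x (∈-∪ˡ (fv t) (fv u) x i))
  (/-cong u λ x i → eq x (∈-∪ʳ (fv t) (fv u) x i))

mutual
  ⟦_⟧ᶜ : Closure → Term 0
  ⟦ clo o t e ⟧ᶜ = t / ⟦ e ⟧ᵉ

  -- A variable without an entry does not occur, so its image is arbitrary.
  ⟦_⟧ᵉ : ∀ {n} → Env n → Sub Term n 0
  ⟦ ∅ ⟧ᵉ         = Vec.[]
  ⟦ _ ↦ c ∷ e ⟧ᵉ = ⟦ c ⟧ᶜ Vec.∷ ⟦ e ⟧ᵉ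
  ⟦ ∙∷ e ⟧ᵉ      = ƛ (var zero) Vec.∷ ⟦ e ⟧ᵉ

apply : Term 0 → Stack → Term 0
apply t []      = t
apply t (c ∷ π) = apply (t · ⟦ c ⟧ᶜ) π

⟦_⟧ : State → Term 0
⟦ ⟪ o , t , e , π ⟫ ⟧ = apply (t / ⟦ e ⟧ᵉ) π

lookup-restrict : ∀ {n} (e : Env n) (p : Subset n) x → lookup p x ≡ inside →
                  lookup ⟦ restrict e p ⟧ᵉ x ≡ lookup ⟦ e ⟧ᵉ x
lookup-restrict (_ ↦ _ ∷ e) (inside Vec.∷ p)  zero    _ = refl
lookup-restrict (∙∷ e)      (_ Vec.∷ p)       zero    _ = refl
lookup-restrict (_ ↦ _ ∷ e) (inside Vec.∷ p)  (suc x) i = lookup-restrict e p x i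
lookup-restrict (_ ↦ _ ∷ e) (outside Vec.∷ p) (suc x) i = lookup-restrict e p x i
lookup-restrict (∙∷ e)      (_ Vec.∷ p)       (suc x) i = lookup-restrict e p x i

/-↾ : ∀ {n} (t : Term n) (e : Env n) → t / ⟦ e ↾ t ⟧ᵉ ≡ t / ⟦ e ⟧ᵉ
/-↾ t e = /-cong t (lookup-restrict e (fv t))

lookup-⟦⟧ : ∀ {n} (e : Env n) x {c} → e ⟨ x ⟩ ≡ just c → lookup ⟦ e ⟧ᵉ x ≡ ⟦ c ⟧ᶜ
lookup-⟦⟧ (_ ↦ _ ∷ e) zero    refl = refl
lookup-⟦⟧ (_ ↦ _ ∷ e) (suc x) eq   = lookup-⟦⟧ e x eq
lookup-⟦⟧ (∙∷ e)      (suc x) eq   = lookup-⟦⟧ e x eq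

-- A KAM on unscoped terms, with bounds instead of addresses

-- Without scopes, a closed program is the same code under any number of binders, and transitions
-- can be computed by evaluation.
data Raw : Set where
  var : ℕ → Raw
  ƛ   : Raw → Raw
  _·_ : Raw → Raw → Raw

erase : ∀ {n} → Term n → Raw
erase (var x) = var (toℕ x)
erase (ƛ t)   = ƛ (erase t)
erase (t · u) = erase t · erase u

infixr 6 _⋓_

_⋓_ : List Bool → List Bool → List Bool
[]       ⋓ ys       = ys
(x ∷ xs) ⋓ []       = x ∷ xs
(x ∷ xs) ⋓ (y ∷ ys) = (x ∨ y) ∷ (xs ⋓ ys)

⋓-identityʳ : ∀ xs → xs ⋓ [] ≡ xs
⋓-identityʳ []      = refl
⋓-identityʳ (_ ∷ _) = refl

singleton : ℕ → List Bool
singleton zero    = true ∷ []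
singleton (suc x) = false ∷ singleton x

behead : List Bool → List Bool
behead []       = []
behead (_ ∷ xs) = xs

first : List Bool → Bool
first []      = false
first (x ∷ _) = x

-- The membership list of the free variables, ending with the last of them.
rawFv : Raw → List Bool
rawFv (var x) = singleton x
rawFv (ƛ t)   = behead (rawFv t)
rawFv (t · u) = rawFv t ⋓ rawFv u

-- The tag g bounds the length of every address inside the closure.
data RawClosure : Set where
  clo : (g : ℕ) (t : Raw) (e : List (Maybe (ℕ × RawClosure))) → RawClosure

RawEnv : Set
RawEnv = List (Maybe (ℕ × RawClosure))

-- The result has no trailing missing entry, so that the restriction to
-- the variables of a closed term is [] by computation.
prune : RawEnv → List Bool → RawEnv
prune []      _            = []
prune (_ ∷ _) []           = []
prune (m ∷ e) (true ∷ xs)  = m ∷ prune e xs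
prune (_ ∷ e) (false ∷ xs) with prune e xs
... | []     = []
... | m ∷ e′ = nothing ∷ m ∷ e′

prune-[] : ∀ r → prune r [] ≡ []
prune-[] []      = refl
prune-[] (_ ∷ _) = refl

find : RawEnv → ℕ → Maybe RawClosure
find []      _       = nothing
find (m ∷ _) zero    = Maybe.map proj₂ m
find (_ ∷ e) (suc x) = find e x

-- A dropped argument leaves a missing entry, so that the indices of the other variables keep their
-- positions.
bind : Bool → ℕ → RawClosure → Maybe (ℕ × RawClosure)
bind true  g c = just (g , c)
bind false _ _ = nothing

data RawState : Set where
  ⟪_∣_∣_∣_⟫ : ℕ → Raw → RawEnv → List RawClosure → RawState

-- A closure stores only the body of its abstraction: in the deterministic fragment an argument is
-- an abstraction or a variable, and variables are looked up.
enter : RawClosure → List RawClosure → RawState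
enter (clo g t e) π = ⟪ g ∣ ƛ t ∣ e ∣ π ⟫

-- The number is 1 for a transition that decodes to a β-step and 0 for the others.
next : RawState → Maybe (ℕ × RawState)
next ⟪ g ∣ var x ∣ e ∣ π ⟫           = Maybe.map (λ c → 0 , enter c π) (find e x)
next ⟪ g ∣ ƛ t ∣ e ∣ [] ⟫            = nothing
next ⟪ g ∣ ƛ t ∣ e ∣ c ∷ π ⟫         = just (1 , ⟪ g ∣ t ∣ bind (first (rawFv t)) g c ∷ e ∣ π ⟫)
next ⟪ g ∣ t · var x ∣ e ∣ π ⟫       =
  Maybe.map (λ c → 0 , ⟪ g ∣ t ∣ prune e (rawFv t) ∣ c ∷ π ⟫) (find e x)
next ⟪ g ∣ t · ƛ u ∣ e ∣ π ⟫         =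
  just (0 , ⟪ g ∣ t ∣ prune e (rawFv t) ∣ clo g u (prune e (rawFv (ƛ u))) ∷ π ⟫)
next ⟪ g ∣ t · (u · u′) ∣ e ∣ π ⟫   = nothing

mutual
  cloSize : RawClosure → ℕ
  cloSize (clo g t e) = g + envSize e

  envSize : RawEnv → ℕ
  envSize []                 = 0
  envSize (just (g , c) ∷ e) = g + cloSize c + envSize e
  envSize (nothing ∷ e)      = envSize e

stackSize : List RawClosure → ℕ
stackSize []      = 0
stackSize (c ∷ π) = cloSize c + stackSize π

size : RawState → ℕ
size ⟪ g ∣ t ∣ e ∣ π ⟫ = g + envSize e + stackSize π

-- Relation between the Space KAM and the raw machine

data FvRel : ∀ {n} → Subset n → List Bool → Set where
  nil  : FvRel Vec.[] []
  out  : ∀ {n} {p : Subset n} → FvRel p [] → FvRel (outside Vec.∷ p) []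
  cons : ∀ {n b xs} {p : Subset n} → FvRel p xs → FvRel (b Vec.∷ p) (b ∷ xs)

FvRel-⊥ : ∀ n → FvRel {n} ⊥ []
FvRel-⊥ zero    = nil
FvRel-⊥ (suc n) = out (FvRel-⊥ n)

FvRel-⁅⁆ : ∀ {n} (x : Fin n) → FvRel ⁅ x ⁆ (singleton (toℕ x))
FvRel-⁅⁆ zero    = cons (FvRel-⊥ _)
FvRel-⁅⁆ (suc x) = cons (FvRel-⁅⁆ x)

FvRel-∪ : ∀ {n xs ys} {p q : Subset n} → FvRel p xs → FvRel q ys → FvRel (p ∪ q) (xs ⋓ ys)
FvRel-∪ nil nil = nil
FvRel-∪ (out p) (out q) = out (FvRel-∪ p q)
FvRel-∪ (out p) (cons q) = cons (FvRel-∪ p q)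
FvRel-∪ {p = true Vec.∷ _} (cons p) (out q) = cons (subst (FvRel _) (⋓-identityʳ _) (FvRel-∪ p q))
FvRel-∪ {p = false Vec.∷ _} (cons p) (out q) = cons (subst (FvRel _) (⋓-identityʳ _) (FvRel-∪ p q))
FvRel-∪ (cons p) (cons q) = cons (FvRel-∪ p q)

FvRel-tail : ∀ {n xs} {p : Subset (suc n)} → FvRel p xs → FvRel (tail p) (behead xs)
FvRel-tail (out p)  = p
FvRel-tail (cons p) = p

FvRel-fv : ∀ {n} (t : Term n) → FvRel (fv t) (rawFv (erase t))
FvRel-fv (var x) = FvRel-⁅⁆ x
FvRel-fv (ƛ t)   = FvRel-tail (FvRel-fv t)
FvRel-fv (t · u) = FvRel-∪ (FvRel-fv t) (FvRel-fv u)

-- The index `o + ∣ t ∣` lies just past the last constructor of the occurrence, so a bound on its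
-- length is inherited by all sub-terms. This is how the tag survives the transitions.
mutual
  data EnvRel : ∀ {n} → Env n → RawEnv → Set where
    nil  : EnvRel ∅ []
    out  : ∀ {n} {e : Env n} → EnvRel e [] → EnvRel (∙∷ e) []
    skip : ∀ {n r} {e : Env n} → EnvRel e r → EnvRel (∙∷ e) (nothing ∷ r)
    cons : ∀ {n a g c d r} {e : Env n} → bits a ≤ g → CloRel c d → EnvRel e r →
           EnvRel (a ↦ c ∷ e) (just (g , d) ∷ r)

  data CloRel : Closure → RawClosure → Set where
    clo : ∀ {n o g r} {t : Term (suc n)} {e : Env n} → bits (o + ∣ ƛ t ∣) ≤ g → EnvRel e r →
          CloRel (clo o (ƛ t) e) (clo g (erase t) r)

data StateRel : State → RawState → Set where
  rel : ∀ {n o g r π ρ} {t : Term n} {e : Env n} → bits (o + ∣ t ∣) ≤ g → EnvRel e r →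
        Pointwise CloRel π ρ → StateRel ⟪ o , t , e , π ⟫ ⟪ g ∣ erase t ∣ r ∣ ρ ⟫

EnvRel-prune : ∀ {n r xs} {e : Env n} {p : Subset n} → EnvRel e r → FvRel p xs →
               EnvRel (restrict e p) (prune r xs)
EnvRel-prune nil nil = nil
EnvRel-prune (out e) (out p) = out (EnvRel-prune e p)
EnvRel-prune {xs = _ ∷ xs} (out e) (cons p) = out (EnvRel-prune {xs = xs} e p)
EnvRel-prune {r = _ ∷ r} (skip e) (out p) =
  out (subst (EnvRel _) (prune-[] r) (EnvRel-prune e p))
EnvRel-prune (skip e) (cons {b = true} p) = skip (EnvRel-prune e p)
EnvRel-prune {r = _ ∷ r} {xs = _ ∷ xs} (skip e) (cons {b = false} p)
  with prune r xs | EnvRel-prune e p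
... | []    | e′ = out e′
... | _ ∷ _ | e′ = skip e′
EnvRel-prune {r = _ ∷ r} (cons a c e) (out p) =
  out (subst (EnvRel _) (prune-[] r) (EnvRel-prune e p))
EnvRel-prune (cons a c e) (cons {b = true} p) = cons a c (EnvRel-prune e p)
EnvRel-prune {r = _ ∷ r} {xs = _ ∷ xs} (cons a c e) (cons {b = false} p)
  with prune r xs | EnvRel-prune e p
... | []    | e′ = out e′
... | _ ∷ _ | e′ = skip e′

EnvRel-find : ∀ {n r d} {e : Env n} → EnvRel e r → ∀ x → find r (toℕ x) ≡ just d →
              ∃[ c ] e ⟨ x ⟩ ≡ just c × CloRel c d
EnvRel-find (skip e)     (suc x) eq   = EnvRel-find e x eq
EnvRel-find (cons a c e) zero    refl = _ , refl , c
EnvRel-find (cons a c e) (suc x) eq   = EnvRel-find e x eq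

mutual
  costEnv≤ : ∀ {n r} {e : Env n} → EnvRel e r → costEnv e ≤ envSize r
  costEnv≤ nil          = z≤n
  costEnv≤ (out e)      = costEnv≤ e
  costEnv≤ (skip e)     = costEnv≤ e
  costEnv≤ (cons a c e) = +-mono-≤ (+-mono-≤ a (costClosure≤ c)) (costEnv≤ e)

  costClosure≤ : ∀ {c d} → CloRel c d → costClosure c ≤ cloSize d
  costClosure≤ (clo {o = o} g e) =
    +-mono-≤ (≤-trans (s≤s (⌊log₂⌋-mono-≤ (m≤m+n o _))) g) (costEnv≤ e)

bits-mono : ∀ {m n} → m ≤ n → bits m ≤ bits n
bits-mono m≤n = s≤s (⌊log₂⌋-mono-≤ m≤n)

address≤ : ∀ {n} o (t : Term n) → address o t ≤ o + ∣ t ∣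
address≤ o (var x) = m≤m+n o 1
address≤ o (ƛ t)   = m≤m+n o _
address≤ o (t · u) = +-monoʳ-≤ o (m≤m+n ∣ t ∣ _)

costStack≤ : ∀ {π ρ} → Pointwise CloRel π ρ → sum (map costClosure π) ≤ stackSize ρ
costStack≤ []      = z≤n
costStack≤ (c ∷ π) = +-mono-≤ (costClosure≤ c) (costStack≤ π)

space≤size : ∀ {s r} → StateRel s r → space s ≤ size r
space≤size (rel {o = o} {t = t} g e π) =
  +-mono-≤ (+-mono-≤ (≤-trans (bits-mono (address≤ o t)) g) (costEnv≤ e)) (costStack≤ π)

CloRel⇒IsValue : ∀ {c d} → CloRel c d → IsValue ⟦ c ⟧ᶜ
CloRel⇒IsValue (clo _ _) = ƛ _

apply-→det : ∀ {t u π ρ} → Pointwise CloRel π ρ → t →det u → apply t π →det apply u π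
apply-→det []      r = r
apply-→det (c ∷ π) r = apply-→det π (argʳ r (CloRel⇒IsValue c))

apply-β : ∀ {n} (t : Term (suc n)) (e : Env n) {c d π ρ} → CloRel c d → Pointwise CloRel π ρ →
          apply ((ƛ t / ⟦ e ⟧ᵉ) · ⟦ c ⟧ᶜ) π →det apply (t / (⟦ c ⟧ᶜ Vec.∷ ⟦ e ⟧ᵉ)) π
apply-β t e {c} cd q = apply-→det q
  (subst ((ƛ t / ⟦ e ⟧ᵉ) · ⟦ c ⟧ᶜ →det_) (β-/ t ⟦ e ⟧ᵉ ⟦ c ⟧ᶜ)
         (β {t = t / ⟦ e ⟧ᵉ ↑} (CloRel⇒IsValue cd)))

first-∈ : ∀ {n xs} {p : Subset (suc n)} → FvRel p xs → first xs ≡ true → zero ∈ p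
first-∈ (cons p) refl = here

first-∉ : ∀ {n xs} {p : Subset (suc n)} → FvRel p xs → first xs ≡ false → zero ∉ p
first-∉ (out p)  _    ()
first-∉ (cons p) refl ()

DetSteps : ℕ → Term 0 → Term 0 → Set
DetSteps k t u = ∃ λ (σ : Star _→det_ t u) → steps σ ≡ k

∣∣-split : ∀ {n} o (t u : Term n) → suc (o + ∣ t ∣) + ∣ u ∣ ≡ o + ∣ t · u ∣
∣∣-split o t u = trans (sym (+-suc (o + ∣ t ∣) ∣ u ∣)) (+-assoc o ∣ t ∣ (suc ∣ u ∣))

-- Only the consumption of an argument decodes to a β-step; the other transitions change the
-- representation of the decoded term but not the term.
simulate : ∀ {s r k r′} → StateRel s r → next r ≡ just (k , r′) →
           ∃[ s′ ] s →KAM s′ × StateRel s′ r′ × DetSteps k ⟦ s ⟧ ⟦ s′ ⟧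
simulate (rel {r = r} {π = π} {t = var x} {e = e} g ρ q) eq with find r (toℕ x) in found
simulate (rel {π = π} {t = var x} {e = e} g ρ q) refl | just d with EnvRel-find ρ x found
... | _ , eq , clo g′ ρ′ rewrite lookup-⟦⟧ e x eq = _ , var eq , rel g′ ρ′ q , ε , refl
simulate (rel {t = ƛ t} g ρ (cd ∷ q)) eq with first (rawFv (erase t)) in occurs
simulate (rel {o = o} {g = k} {t = ƛ t} {e = e} g ρ (cd ∷ q)) refl | true =
  _ , lam-bind (first-∈ (FvRel-fv t) occurs) ,
  rel (subst (λ a → bits a ≤ k) (+-suc o ∣ t ∣) g)
      (cons (≤-trans (bits-mono (m≤m+n o _)) g) cd ρ) q ,
  apply-β t e cd q ◅ ε , refl
simulate (rel {o = o} {g = k} {t = ƛ t} {e = e} g ρ (_∷_ {x = c} {xs = π} cd q)) refl | false =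
  _ , lam-drop (first-∉ (FvRel-fv t) occurs) ,
  rel (subst (λ a → bits a ≤ k) (+-suc o ∣ t ∣) g) (skip ρ) q ,
  -- The bound variable does not occur in the body, so the contractum is the same with the
  -- placeholder of a missing entry in place of the argument.
  subst (λ u → apply ((ƛ t / ⟦ e ⟧ᵉ) · ⟦ c ⟧ᶜ) π →det apply u π)
        (/-cong t agree) (apply-β t e cd q) ◅ ε , refl
  where
  agree : ∀ x → lookup (fv t) x ≡ inside →
          lookup (⟦ c ⟧ᶜ Vec.∷ ⟦ e ⟧ᵉ) x ≡ lookup (ƛ (var zero) Vec.∷ ⟦ e ⟧ᵉ) x
  agree zero    i with () ← first-∉ (FvRel-fv t) occurs (Vec.lookup⇒[]= zero (fv t) i)
  agree (suc x) _ = refl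
simulate (rel {r = r} {t = t · var x} {e = e} g ρ q) eq with find r (toℕ x) in found
simulate (rel {o = o} {π = π} {t = t · var x} {e = e} g ρ q) refl | just d
  with EnvRel-find ρ x found
... | c , eq , cd =
  _ , app-var eq ,
  rel (≤-trans (bits-mono (+-monoʳ-≤ o (m≤m+n ∣ t ∣ _))) g) (EnvRel-prune ρ (FvRel-fv t)) (cd ∷ q) ,
  subst (DetSteps 0 _)
        (cong (λ a → apply a π) (cong₂ _·_ (sym (/-↾ t e)) (lookup-⟦⟧ e x eq))) (ε , refl)
simulate (rel {o = o} {g = k} {π = π} {t = t · ƛ u} {e = e} g ρ q) refl =
  _ , app (λ ()) ,
  rel (≤-trans (bits-mono (+-monoʳ-≤ o (m≤m+n ∣ t ∣ _))) g) (EnvRel-prune ρ (FvRel-fv t))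
    (clo (subst (λ a → bits a ≤ k) (sym (∣∣-split o t (ƛ u))) g)
         (EnvRel-prune ρ (FvRel-fv (ƛ u))) ∷ q) ,
  subst (DetSteps 0 _)
        (cong (λ a → apply a π) (cong₂ _·_ (sym (/-↾ t e)) (sym (/-↾ (ƛ u) e)))) (ε , refl)

-- Paths with bounded space

data Path (B : ℕ) : RawState → ℕ → RawState → Set where
  done : ∀ {s} → size s ≤ B → Path B s 0 s
  _∷_  : ∀ {s k s′ l s″} → size s ≤ B × next s ≡ just (k , s′) → Path B s′ l s″ →
         Path B s (k + l) s″

Path-mono : ∀ {B B′ s k s′} → B ≤ B′ → Path B s k s′ → Path B′ s k s′
Path-mono B≤B′ (done b)       = done (≤-trans b B≤B′)
Path-mono B≤B′ ((b , eq) ∷ p) = (≤-trans b B≤B′ , eq) ∷ Path-mono B≤B′ p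

Path-++ : ∀ {B s k s′ l s″} → Path B s k s′ → Path B s′ l s″ → Path B s (k + l) s″
Path-++ (done _)                       q = q
Path-++ {B} {s} {l = l} {s″} (_∷_ {k = k} {l = k′} b p) q =
  subst (λ n → Path B s n s″) (sym (+-assoc k k′ l)) (b ∷ Path-++ p q)

Path-last : ∀ {B s k s′} → Path B s k s′ → size s′ ≤ B
Path-last (done b) = b
Path-last (_ ∷ p)  = Path-last p

steps-◅◅ : ∀ {A : Set} {_⟶_ : A → A → Set} {x y z} (ρ : Star _⟶_ x y) (σ : Star _⟶_ y z) →
           steps (ρ ◅◅ σ) ≡ steps ρ + steps σ
steps-◅◅ ε       σ = refl
steps-◅◅ (_ ◅ ρ) σ = cong suc (steps-◅◅ ρ σ)

realize : ∀ {B s r k r′} → StateRel s r → Path B r k r′ →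
          ∃[ s′ ] StateRel s′ r′ × (∃ λ (κ : Star _→KAM_ s s′) → S-KAM κ ≤ B) ×
                  DetSteps k ⟦ s ⟧ ⟦ s′ ⟧
realize sr (done b) = _ , sr , (ε , ≤-trans (space≤size sr) b) , ε , refl
realize sr ((b , eq) ∷ p) with simulate sr eq
... | _ , κ₁ , sr₁ , σ₁ , refl with realize sr₁ p
... | _ , sr₂ , (κ , c) , σ₂ , refl =
  _ , sr₂ , (κ₁ ◅ κ , ⊔-lub (≤-trans (space≤size sr) b) c) , σ₁ ◅◅ σ₂ , steps-◅◅ σ₁ σ₂

-- Growth of the size along a path

prune-≤ : ∀ e xs → envSize (prune e xs) ≤ envSize e
prune-≤ []                 _            = z≤n
prune-≤ (_ ∷ _)            []           = z≤n
prune-≤ (just (g , c) ∷ e) (true ∷ xs)  = +-monoʳ-≤ (g + cloSize c) (prune-≤ e xs)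
prune-≤ (nothing ∷ e)      (true ∷ xs)  = prune-≤ e xs
prune-≤ (just (g , c) ∷ e) (false ∷ xs) with prune e xs | prune-≤ e xs
... | []    | _ = z≤n
... | _ ∷ _ | b = ≤-trans b (m≤n+m (envSize e) (g + cloSize c))
prune-≤ (nothing ∷ e)      (false ∷ xs) with prune e xs | prune-≤ e xs
... | []    | _ = z≤n
... | _ ∷ _ | b = b

find-≤ : ∀ e x {c} → find e x ≡ just c → cloSize c ≤ envSize e
find-≤ (just (g , c) ∷ e) zero    refl = ≤-trans (m≤n+m (cloSize c) g) (m≤m+n _ (envSize e))
find-≤ (just (g , c) ∷ e) (suc x) eq   = ≤-trans (find-≤ e x eq) (m≤n+m (envSize e) _)
find-≤ (nothing ∷ e)      (suc x) eq   = find-≤ e x eq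

size-enter : ∀ c π → size (enter c π) ≡ cloSize c + stackSize π
size-enter (clo g t e) π = refl

bind-≤ : ∀ b g c e → envSize (bind b g c ∷ e) ≤ g + cloSize c + envSize e
bind-≤ true  g c e = ≤-refl
bind-≤ false g c e = m≤n+m (envSize e) _

-- A transition adds at most one address and one copy of a part of the environment, and the old
-- state already counts both.
next-≤ : ∀ s {k s′} → next s ≡ just (k , s′) → size s′ ≤ 2 * size s
next-≤ ⟪ g ∣ var x ∣ e ∣ π ⟫ eq with find e x in found
next-≤ ⟪ g ∣ var x ∣ e ∣ π ⟫ refl | just c = begin
  size (enter c π)                      ≡⟨ size-enter c π ⟩
  cloSize c + stackSize π               ≤⟨ +-monoˡ-≤ (stackSize π) (find-≤ e x found) ⟩
  envSize e + stackSize π               ≤⟨ +-monoˡ-≤ (stackSize π) (m≤n+m (envSize e) g) ⟩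
  g + envSize e + stackSize π           ≤⟨ m≤n*m _ 2 ⟩
  2 * (g + envSize e + stackSize π)     ∎
  where open ≤-Reasoning
next-≤ ⟪ g ∣ ƛ t ∣ e ∣ c ∷ π ⟫ refl = begin
  g + envSize (bind (first (rawFv t)) g c ∷ e) + stackSize π
    ≤⟨ +-monoˡ-≤ (stackSize π) (+-monoʳ-≤ g (bind-≤ (first (rawFv t)) g c e)) ⟩
  g + (g + cloSize c + envSize e) + stackSize π
    ≤⟨ m≤m+n _ (envSize e + cloSize c + stackSize π) ⟩
  g + (g + cloSize c + envSize e) + stackSize π + (envSize e + cloSize c + stackSize π)
    ≡⟨ double g (envSize e) (cloSize c) (stackSize π) ⟩
  2 * (g + envSize e + (cloSize c + stackSize π)) ∎
  where
  open ≤-Reasoning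
  double : ∀ g e c π → g + (g + c + e) + π + (e + c + π) ≡ 2 * (g + e + (c + π))
  double = solve-∀
next-≤ ⟪ g ∣ t · var x ∣ e ∣ π ⟫ eq with find e x in found
next-≤ ⟪ g ∣ t · var x ∣ e ∣ π ⟫ refl | just c = begin
  g + envSize (prune e (rawFv t)) + (cloSize c + stackSize π)
    ≤⟨ +-mono-≤ (+-monoʳ-≤ g (prune-≤ e (rawFv t))) (+-monoˡ-≤ (stackSize π) (find-≤ e x found)) ⟩
  g + envSize e + (envSize e + stackSize π)
    ≤⟨ m≤m+n _ (g + stackSize π) ⟩
  g + envSize e + (envSize e + stackSize π) + (g + stackSize π)
    ≡⟨ double g (envSize e) (stackSize π) ⟩
  2 * (g + envSize e + stackSize π) ∎
  where
  open ≤-Reasoning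
  double : ∀ g e π → g + e + (e + π) + (g + π) ≡ 2 * (g + e + π)
  double = solve-∀
next-≤ ⟪ g ∣ t · ƛ u ∣ e ∣ π ⟫ refl = begin
  g + envSize (prune e (rawFv t)) + (g + envSize (prune e (rawFv (ƛ u))) + stackSize π)
    ≤⟨ +-mono-≤ (+-monoʳ-≤ g (prune-≤ e (rawFv t)))
                (+-monoˡ-≤ (stackSize π) (+-monoʳ-≤ g (prune-≤ e (rawFv (ƛ u))))) ⟩
  g + envSize e + (g + envSize e + stackSize π)
    ≤⟨ m≤m+n _ (stackSize π) ⟩
  g + envSize e + (g + envSize e + stackSize π) + stackSize π
    ≡⟨ double g (envSize e) (stackSize π) ⟩
  2 * (g + envSize e + stackSize π) ∎
  where
  open ≤-Reasoning
  double : ∀ g e π → g + e + (g + e + π) + π ≡ 2 * (g + e + π)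
  double = solve-∀

run : ℕ → RawState → Maybe (ℕ × RawState)
run zero    s = just (0 , s)
run (suc m) s = next s >>= λ where
  (k , s′) → Maybe.map (λ where (l , s″) → k + l , s″) (run m s′)

run-path : ∀ m {s k s′} → run m s ≡ just (k , s′) → Path (2 ^ m * size s) s k s′
run-path zero refl = done (m≤n*m _ 1)
run-path (suc m) {s} eq with next s in eq₁
run-path (suc m) {s} eq | just (k , s₁) with run m s₁ in eq₂
run-path (suc m) {s} refl | just (k , s₁) | just (l , s₂) =
  (m≤n*m (size s) (2 ^ suc m) {{m^n≢0 2 (suc m)}} , eq₁) ∷ Path-mono bound (run-path m eq₂)
  where
  open ≤-Reasoning
  bound : 2 ^ m * size s₁ ≤ 2 ^ suc m * size s
  bound = begin
    2 ^ m * size s₁      ≤⟨ *-monoʳ-≤ (2 ^ m) (next-≤ s eq₁) ⟩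
    2 ^ m * (2 * size s) ≡⟨ sym (*-assoc (2 ^ m) 2 (size s)) ⟩
    2 ^ m * 2 * size s   ≡⟨ cong (_* size s) (*-comm (2 ^ m) 2) ⟩
    2 ^ suc m * size s   ∎

-- The space bound is relative to the initial state, so that composition
-- adds the exponents, and a run of m transitions has exponent m.
record _⇒⟨_,_,_⟩_ (s : RawState) (m lo hi : ℕ) (s′ : RawState) : Set where
  constructor mk
  field
    {count} : ℕ
    lo≤     : lo ≤ count
    ≤hi     : count ≤ hi
    path    : Path (2 ^ m * size s) s count s′

infixr 5 _⨾_

-- Where the code is concrete and only the closures around it are unknown, `run` evaluates and the
-- premise holds by `refl`.
compute : ∀ m {s k s′} → run m s ≡ just (k , s′) → s ⇒⟨ m , k , k ⟩ s′
compute m eq = mk ≤-refl ≤-refl (run-path m eq)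

_⨾_ : ∀ {s m₁ l₁ h₁ s′ m₂ l₂ h₂ s″} → s ⇒⟨ m₁ , l₁ , h₁ ⟩ s′ → s′ ⇒⟨ m₂ , l₂ , h₂ ⟩ s″ →
      s ⇒⟨ m₁ + m₂ , l₁ + l₂ , h₁ + h₂ ⟩ s″
_⨾_ {s} {m₁} {s′ = s′} {m₂} (mk l₁ h₁ p) (mk l₂ h₂ q) =
  mk (+-mono-≤ l₁ l₂) (+-mono-≤ h₁ h₂) (Path-++ (Path-mono b₁ p) (Path-mono b₂ q))
  where
  open ≤-Reasoning
  b₁ : 2 ^ m₁ * size s ≤ 2 ^ (m₁ + m₂) * size s
  b₁ = *-monoˡ-≤ (size s) (^-monoʳ-≤ 2 (m≤m+n m₁ m₂))
  b₂ : 2 ^ m₂ * size s′ ≤ 2 ^ (m₁ + m₂) * size s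
  b₂ = begin
    2 ^ m₂ * size s′             ≤⟨ *-monoʳ-≤ (2 ^ m₂) (Path-last p) ⟩
    2 ^ m₂ * (2 ^ m₁ * size s)   ≡⟨ sym (*-assoc (2 ^ m₂) (2 ^ m₁) (size s)) ⟩
    2 ^ m₂ * 2 ^ m₁ * size s     ≡⟨ cong (_* size s) (*-comm (2 ^ m₂) (2 ^ m₁)) ⟩
    2 ^ m₁ * 2 ^ m₂ * size s     ≡⟨ cong (_* size s) (sym (^-distribˡ-+-* 2 m₁ m₂)) ⟩
    2 ^ (m₁ + m₂) * size s       ∎

-- With _⨾_ the exponent would grow with the number of iterations.
loop : ∀ {s m l₁ h₁ s′ l₂ h₂ s″} → s ⇒⟨ m , l₁ , h₁ ⟩ s′ → size s′ ≤ size s →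
       s′ ⇒⟨ m , l₂ , h₂ ⟩ s″ → s ⇒⟨ m , l₁ + l₂ , h₁ + h₂ ⟩ s″
loop {m = m} (mk l₁ h₁ p) s′≤s (mk l₂ h₂ q) =
  mk (+-mono-≤ l₁ l₂) (+-mono-≤ h₁ h₂) (Path-++ p (Path-mono (*-monoʳ-≤ (2 ^ m) s′≤s) q))

relax : ∀ {s m m′ l l′ h h′ s′} → m ≤ m′ → l′ ≤ l → h ≤ h′ →
        s ⇒⟨ m , l , h ⟩ s′ → s ⇒⟨ m′ , l′ , h′ ⟩ s′
relax {s} m≤ l≤ h≤ (mk l h p) =
  mk (≤-trans l≤ l) (≤-trans h h≤) (Path-mono (*-monoˡ-≤ (size s) (^-monoʳ-≤ 2 m≤)) p)

-- Programs

-- The test for values: variables pass it as well, being allowed as arguments.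
isƛ : Raw → Bool
isƛ (var _) = true
isƛ (ƛ _)   = true
isƛ (_ · _) = false

-- Scoping and membership in Λ_det together.
wf : ℕ → Raw → Bool
wf k (var x) = x <ᵇ k
wf k (ƛ t)   = wf (suc k) t
wf k (t · u) = wf k t ∧ (wf k u ∧ isƛ u)

∧-true : ∀ {a b} → a ∧ b ≡ true → a ≡ true × b ≡ true
∧-true {true} {true} refl = refl , refl

-- Programs are written raw and checked by evaluating `wf`; this turns the finished code into a
-- scoped term of the fragment.
toTerm : ∀ k t → wf k t ≡ true → ∃ λ (u : Term k) → erase u ≡ t × Det u
toTerm k (var x) eq = var (fromℕ< x<k) , cong var (toℕ-fromℕ< x<k) , var _
  where
  x<k : x < k
  x<k = <ᵇ⇒< x k (subst T (sym eq) _)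
toTerm k (ƛ t) eq with toTerm (suc k) t eq
... | u , refl , d = ƛ u , refl , ƛ d
toTerm k (t · u) eq with ∧-true {wf k t} eq
... | eq₁ , eq′ with ∧-true {wf k u} eq′
... | eq₂ , v with toTerm k t eq₁ | toTerm k u eq₂
... | t′ , refl , dt | var x , refl , du = t′ · var x , refl , app dt du (var x)
... | t′ , refl , dt | ƛ u′  , refl , du = t′ · ƛ u′ , refl , app dt du (ƛ u′)

wf-suc : ∀ k t → wf k t ≡ true → wf (suc k) t ≡ true
wf-suc k (var x) eq = T⇒≡ (<⇒<ᵇ (m<n⇒m<1+n (<ᵇ⇒< x k (subst T (sym eq) _))))
  where
  T⇒≡ : ∀ {b} → T b → b ≡ true
  T⇒≡ {true} _ = refl
wf-suc k (ƛ t) eq = wf-suc (suc k) t eq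
wf-suc k (t · u) eq with ∧-true {wf k t} eq
... | eq₁ , eq′ with ∧-true {wf k u} eq′
... | eq₂ , v = cong₂ _∧_ (wf-suc k t eq₁) (cong₂ _∧_ (wf-suc k u eq₂) v)

length-⋓ : ∀ {k} xs ys → length xs ≤ k → length ys ≤ k → length (xs ⋓ ys) ≤ k
length-⋓ []       ys       _       q       = q
length-⋓ (x ∷ xs) []       p       _       = p
length-⋓ (x ∷ xs) (y ∷ ys) (s≤s p) (s≤s q) = s≤s (length-⋓ xs ys p q)

length-rawFv : ∀ k t → wf k t ≡ true → length (rawFv t) ≤ k
length-rawFv k (var x) eq = go x (<ᵇ⇒< x k (subst T (sym eq) _))
  where
  go : ∀ {k} x → x < k → length (singleton x) ≤ k
  go zero    (s≤s p) = s≤s z≤n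
  go (suc x) (s≤s p) = s≤s (go x p)
length-rawFv k (ƛ t) eq with rawFv t | length-rawFv (suc k) t eq
... | []    | _     = z≤n
... | _ ∷ _ | s≤s p = p
length-rawFv k (t · u) eq with ∧-true {wf k t} eq
... | eq₁ , eq′ = length-⋓ (rawFv t) (rawFv u) (length-rawFv k t eq₁)
                           (length-rawFv k u (proj₁ (∧-true {wf k u} eq′)))

record Comb : Set where
  constructor comb
  field
    body : Raw
    ok   : wf 1 body ≡ true

  term : Raw
  term = ƛ body

  -- It holds for unknown code too, and rewriting with it lets `prune` yield the empty environment
  -- of a closed program.
  term-fv : rawFv term ≡ []
  term-fv with rawFv term | length-rawFv 0 term ok
  ... | [] | _ = refl

open Comb using (body; ok; term; term-fv)

val : ℕ → Comb → RawClosure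
val g C = clo g (body C) []

infixl 9 _∙_

-- Terms with bound variables as functions, from the number of enclosing
-- binders to the term with indices.
HTerm : Set
HTerm = ℕ → Raw

lam : (HTerm → HTerm) → HTerm
lam f d = ƛ (f (λ d′ → var (d′ ∸ suc d)) (suc d))

_∙_ : HTerm → HTerm → HTerm
(t ∙ u) d = t d · u d

⟨_⟩ : Comb → HTerm
⟨ C ⟩ _ = term C

bodyOf : HTerm → Raw
bodyOf t with t 0
... | ƛ u = u
... | u   = u

-- The η-expansion of an application: the application itself is not a value, and could not be an
-- argument in the fragment.
glue : Comb → Comb → Comb
glue F G = comb (term F · term G · var 0)
  (cong₂ _∧_ (cong₂ _∧_ (wf-suc 0 (term F) (ok F)) (cong (_∧ true) (wf-suc 0 (term G) (ok G))))
             refl)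

-- Programs with unknown closed parts are built by glue only, so that all
-- the other transitions are computed on concrete code.
glue-⇒ : ∀ F G {g c π} → enter (val g (glue F G)) (c ∷ π) ⇒⟨ 3 , 1 , 1 ⟩
                        enter (val g F) (val g G ∷ c ∷ π)
glue-⇒ F G = compute 3 eq
  where
  eq : ∀ {g c π} → run 3 (enter (val g (glue F G)) (c ∷ π)) ≡
                   just (1 , enter (val g F) (val g G ∷ c ∷ π))
  eq rewrite term-fv F | term-fv G = refl

glue₃ : Comb → Comb → Comb → Comb → Comb
glue₃ F A B C = glue (glue (glue F A) B) C

glue₃-⇒ : ∀ F A B C {g c π} → enter (val g (glue₃ F A B C)) (c ∷ π) ⇒⟨ 9 , 3 , 3 ⟩
                              enter (val g F) (val g A ∷ val g B ∷ val g C ∷ c ∷ π)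
glue₃-⇒ F A B C = glue-⇒ (glue (glue F A) B) C ⨾ glue-⇒ (glue F A) B ⨾ glue-⇒ F A

str : List Bool → Comb
str []      = comb (ƛ (ƛ (var 0))) refl
str (b ∷ s) = comb (ƛ (ƛ (var (if b then 1 else 2) · term (str s)))) (eq b)
  where
  eq : ∀ b → wf 1 (ƛ (ƛ (var (if b then 1 else 2) · term (str s)))) ≡ true
  eq b with wf-suc 2 (term (str s)) (wf-suc 1 (term (str s)) (wf-suc 0 (term (str s)) (ok (str s))))
  eq true  | e rewrite e = refl
  eq false | e rewrite e = refl

erase-⌈⌉ : ∀ {n} s → erase (⌈_⌉ {n} s) ≡ term (str s)
erase-⌈⌉ []          = refl
erase-⌈⌉ (false ∷ s) = cong (λ t → ƛ (ƛ (ƛ (var 2 · t)))) (erase-⌈⌉ s)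
erase-⌈⌉ (true ∷ s)  = cong (λ t → ƛ (ƛ (ƛ (var 1 · t)))) (erase-⌈⌉ s)

str-∷-⇒ : ∀ b s {g c₀ c₁ cε π} → enter (val g (str (b ∷ s))) (c₀ ∷ c₁ ∷ cε ∷ π) ⇒⟨ 5 , 3 , 3 ⟩
          enter (if b then c₁ else c₀) (val g (str s) ∷ π)
str-∷-⇒ b s = compute 5 (eq b)
  where
  eq : ∀ b {g c₀ c₁ cε π} → run 5 (enter (val g (str (b ∷ s))) (c₀ ∷ c₁ ∷ cε ∷ π)) ≡
       just (3 , enter (if b then c₁ else c₀) (val g (str s) ∷ π))
  eq true  rewrite term-fv (str s) = refl
  eq false rewrite term-fv (str s) = refl

-- The walk along `a` and `p`, recursive by self-application, hands what remains of `a` to `k` once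
-- `p` is empty. The extra last argument `a` is what `k` receives, and likewise what the branch for
-- an exhausted `a` continues with.
COMP : Comb
COMP = comb (bodyOf (lam λ f → lam λ a → lam λ p → lam λ k →
  let loop = lam λ p′ → lam λ a →
        a ∙ (lam λ a′ → lam λ _ → f ∙ f ∙ a′ ∙ p′ ∙ k)
          ∙ (lam λ a′ → lam λ _ → f ∙ f ∙ a′ ∙ p′ ∙ k)
          ∙ (lam λ a′ → f ∙ f ∙ a′ ∙ p′ ∙ k) ∙ a
  in p ∙ loop ∙ loop ∙ k ∙ a)) refl

-- If `p` is the suffix at offset d, then `q` has length d, and dropping that many bits from the
-- tail `r` gives offset 2d + 1. The two walks take n - d and d iterations, hence n together.
PAD : Comb
PAD = comb (bodyOf (lam λ f → lam λ i → lam λ p → lam λ k →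
  let loop = lam λ r →
        ⟨ COMP ⟩ ∙ ⟨ COMP ⟩ ∙ i ∙ p ∙ (lam λ q →
        ⟨ COMP ⟩ ∙ ⟨ COMP ⟩ ∙ r ∙ q ∙ (lam λ p′ → f ∙ f ∙ i ∙ p′ ∙ k))
  in p ∙ loop ∙ loop ∙ k)) refl

SYM : InputSym → Comb
SYM (bit false) = comb (bodyOf (lam λ x₀ → lam λ x₁ → lam λ xL → lam λ xR → x₀)) refl
SYM (bit true)  = comb (bodyOf (lam λ x₀ → lam λ x₁ → lam λ xL → lam λ xR → x₁)) refl
SYM L           = comb (bodyOf (lam λ x₀ → lam λ x₁ → lam λ xL → lam λ xR → xL)) refl
SYM R           = comb (bodyOf (lam λ x₀ → lam λ x₁ → lam λ xL → lam λ xR → xR)) refl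

-- The variable r must be the innermost one where a cell is built, for its
-- closures to be the ones of tapeClo.
cell : WorkSym → HTerm → HTerm
cell (bit false) r = lam λ x₀ → lam λ x₁ → lam λ x□ → lam λ xε → x₀ ∙ r
cell (bit true)  r = lam λ x₀ → lam λ x₁ → lam λ x□ → lam λ xε → x₁ ∙ r
cell □           r = lam λ x₀ → lam λ x₁ → lam λ x□ → lam λ xε → x□ ∙ r

NIL : Comb
NIL = comb (bodyOf (lam λ x₀ → lam λ x₁ → lam λ x□ → lam λ xε → xε)) refl

CONS : WorkSym → Comb
CONS a = comb (bodyOf (lam λ k → lam λ r → k ∙ cell a r)) (scoped a)
  where
  scoped : ∀ a → wf 1 (bodyOf (lam λ k → lam λ r → k ∙ cell a r)) ≡ true
  scoped (bit false) = refl
  scoped (bit true)  = refl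
  scoped □           = refl

-- The cell under the head is the first one of the right part. The written symbol is pushed on the
-- right part, or on the left part for a move to the right; past the visited cells a blank is
-- created.
WORK : Move → Comb
WORK stay = comb (bodyOf (lam λ cons → lam λ k → lam λ ls → lam λ rs →
  cons ∙ (lam λ rs′ → k ∙ ls ∙ rs′) ∙ rs)) refl
WORK left = comb (bodyOf (lam λ cons → lam λ k → lam λ ls → lam λ rs →
  let pop = λ a → lam λ ls′ → lam λ r → k ∙ ls′ ∙ cell a r in
  cons ∙ (lam λ rs′ → ls ∙ pop (bit false) ∙ pop (bit true) ∙ pop □
                         ∙ (lam λ r → k ∙ ⟨ NIL ⟩ ∙ cell □ r) ∙ rs′) ∙ rs)) refl
WORK right = comb (bodyOf (lam λ cons → lam λ k → lam λ ls → lam λ rs →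
  cons ∙ (lam λ ls′ →
    let old = lam λ _ → lam λ r → k ∙ ls′ ∙ r
        new = lam λ _ → (lam λ n → k ∙ ls′ ∙ cell □ n) ∙ ⟨ NIL ⟩
    in rs ∙ old ∙ old ∙ old ∙ new ∙ rs) ∙ ls)) refl

-- The continuation `k` is itself the branch for the empty string, where it finds `R` and `p` as its
-- arguments. The branches for a bit discard the tail and these two.
READ : Comb
READ = comb (bodyOf (lam λ p → lam λ k →
  let found = λ b → lam λ _ → lam λ _ → lam λ _ → k ∙ ⟨ SYM (bit b) ⟩ ∙ p
  in p ∙ found false ∙ found true ∙ k ∙ ⟨ SYM R ⟩ ∙ p)) refl

AT-L REREAD NEXT BACK : Comb
AT-L   = comb (bodyOf (lam λ i → lam λ p → lam λ k → k ∙ ⟨ SYM L ⟩ ∙ p)) refl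
REREAD = comb (bodyOf (lam λ i → lam λ p → lam λ k → ⟨ READ ⟩ ∙ p ∙ k)) refl
NEXT   = comb (bodyOf (lam λ i → lam λ p → lam λ k →
  let tail = lam λ r → ⟨ READ ⟩ ∙ r ∙ k
  in p ∙ tail ∙ tail ∙ (lam λ x → x))) refl
BACK   = comb (bodyOf (lam λ i → lam λ p → lam λ k →
  ⟨ COMP ⟩ ∙ ⟨ COMP ⟩ ∙ i ∙ p ∙ (lam λ q →
  -- With `p` at offset d, `q` has length d. If it is empty the move reaches `L`; otherwise its tail
  -- has length d - 1, and a second walk gives the suffix at that offset.
  let inside = lam λ q′ → lam λ _ → lam λ _ →
        ⟨ COMP ⟩ ∙ ⟨ COMP ⟩ ∙ i ∙ q′ ∙ (lam λ r → ⟨ READ ⟩ ∙ r ∙ k)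
  in q ∙ inside ∙ inside ∙ k ∙ ⟨ SYM L ⟩ ∙ i))) refl

-- Moves from L are special because L and the first cell of the input share
-- a pointer. A move to the left of L is never made.
fromL fromInside : Move → Comb
fromL left       = AT-L
fromL stay       = AT-L
fromL right      = REREAD
fromInside left  = BACK
fromInside stay  = REREAD
fromInside right = NEXT

INPUT : InputSym → Move → Comb
INPUT (bit _) = fromInside
INPUT L       = fromL
INPUT R       = fromInside

symOf : List Bool → InputSym
symOf []      = R
symOf (b ∷ _) = bit b

INPUT-symOf : ∀ s m → INPUT (symOf s) m ≡ fromInside m
INPUT-symOf []      m = refl
INPUT-symOf (_ ∷ _) m = refl

lookup-suffix : ∀ i (k : Fin (suc (length i))) →
                lookup (inputTape i) (suc k) ≡ symOf (drop (toℕ k) i)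
lookup-suffix []      zero    = refl
lookup-suffix (b ∷ i) zero    = refl
lookup-suffix (b ∷ i) (suc k) = lookup-suffix i k

suffix : (i : List Bool) → Fin (2 + length i) → List Bool
suffix i zero    = i
suffix i (suc k) = drop (toℕ k) i

-- A state is encoded as a projection from a table of nested pairs, whose entries are the rows of
-- the transition function.
SKIP PAIR : Comb
SKIP = comb (bodyOf (lam λ s → lam λ t → t ∙ (lam λ h → lam λ r → s ∙ r))) refl
PAIR = comb (bodyOf (lam λ h → lam λ r → lam λ c → c ∙ h ∙ r)) refl

SEL : ℕ → Comb
SEL zero    = comb (bodyOf (lam λ t → t ∙ (lam λ h → lam λ r → h))) refl
SEL (suc q) = glue SKIP (SEL q)

TABLE : ∀ {n} → (Fin n → Comb) → Comb
TABLE {zero}  _    = comb (bodyOf (lam λ x → x)) refl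
TABLE {suc n} rows = glue (glue PAIR (rows zero)) (TABLE (rows ∘ suc))

SWITCH-SYM SWITCH-CELL STEP : Comb
SWITCH-SYM = comb (bodyOf (lam λ e₀ → lam λ e₁ → lam λ eL → lam λ eR → lam λ s →
  s ∙ e₀ ∙ e₁ ∙ eL ∙ eR)) refl
SWITCH-CELL = comb (bodyOf (lam λ e₀ → lam λ e₁ → lam λ e□ → lam λ p → lam λ ls → lam λ rs →
  -- The right part starts with the cell under the head, so the branch for the empty list is an
  -- arbitrary closed value.
  rs ∙ e₀ ∙ e₁ ∙ e□ ∙ (lam λ x → x) ∙ p ∙ ls)) refl
STEP = comb (bodyOf (lam λ mi → lam λ mw → lam λ cons → lam λ q →
  lam λ rs → lam λ p → lam λ ls → lam λ f → lam λ i →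
  mi ∙ i ∙ p ∙ (lam λ s → lam λ p′ →
  mw ∙ cons ∙ (lam λ ls′ → lam λ rs′ → f ∙ f ∙ i ∙ q ∙ s ∙ p′ ∙ ls′ ∙ rs′) ∙ ls ∙ rs))) refl

HALT : Bool → Comb
HALT true  = comb (bodyOf (lam λ rs → lam λ p → lam λ ls → lam λ f → lam λ i →
  lam λ x → lam λ y → x)) refl
HALT false = comb (bodyOf (lam λ rs → lam λ p → lam λ ls → lam λ f → lam λ i →
  lam λ x → lam λ y → y)) refl

drop-< : ∀ (i : List Bool) d → d < length i → ∃[ b ] drop d i ≡ b ∷ drop (suc d) i
drop-< (b ∷ i) zero    _         = b , refl
drop-< (b ∷ i) (suc d) (s≤s d<n) = drop-< i d d<n

START : Comb
START = comb (bodyOf (lam λ run → lam λ q → lam λ i →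
  (lam λ n → run ∙ run ∙ i ∙ q ∙ ⟨ SYM L ⟩ ∙ i ∙ n ∙ cell □ n) ∙ ⟨ NIL ⟩)) refl

-- The continuation of the padding is the state `q`, which then selects its row of the table; the
-- row consumes the remaining arguments.
LOOP : Comb
LOOP = comb (bodyOf (lam λ table → lam λ f → lam λ i → lam λ q → lam λ s → lam λ p →
  lam λ ls → lam λ rs →
  ⟨ PAD ⟩ ∙ ⟨ PAD ⟩ ∙ i ∙ i ∙ q ∙ table ∙ s ∙ p ∙ ls ∙ rs ∙ f ∙ i)) refl

-- The encoding of a machine

module Encoding (M : TM) where

  open TM M

  act : Fin states → InputSym → Maybe (WorkSym × Move × Move × Fin states) → Comb
  -- A machine blocked in a state that is not final answers `false`, an arbitrary choice.
  act q s nothing                      = HALT (does (q ≟ final true))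
  act q s (just (a′ , mi , mw , q′)) =
    glue (glue₃ STEP (INPUT s mi) (WORK mw) (CONS a′)) (SEL (toℕ q′))

  entry : Fin states → InputSym → WorkSym → Comb
  entry q s a = act q s (δ q s a)

  cells-row : Fin states → InputSym → Comb
  cells-row q s =
    glue₃ SWITCH-CELL (entry q s (bit false)) (entry q s (bit true)) (entry q s □)

  row : Fin states → Comb
  row q = glue (glue₃ SWITCH-SYM (cells-row q (bit false)) (cells-row q (bit true)) (cells-row q L))
               (cells-row q R)

  RUN : Comb
  RUN = glue LOOP (TABLE row)

  MACHINE : Comb
  MACHINE = glue (glue START RUN) (SEL (toℕ start))

  -- Abstract, because the unfolding of 2 ^ expʳ is huge.
  abstract
    expʳ : ℕ
    expʳ = 357 + 23 * states

    expʳ-≡ : expʳ ≡ 357 + 23 * states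
    expʳ-≡ = refl

  -- A bound on the β-steps per transition: the rounds of the padding, the two walks of a move to
  -- the left, and a part constant in the input, which includes the search in the table.
  hiʳ : ℕ → ℕ → ℕ
  hiʳ n l = suc l * (14 * n + 24) + (28 * n + (150 + 10 * states))

booleanTerm : Bool → Raw
booleanTerm true  = ƛ (ƛ (var 1))
booleanTerm false = ƛ (ƛ (var 0))

-- Logarithms

2^⌊log₂⌋≤ : ∀ n → n ≥ 1 → 2 ^ ⌊log₂ n ⌋ ≤ n
2^⌊log₂⌋≤ = <-rec _ go
  where
  open ≤-Reasoning
  go : ∀ n → (∀ {m} → m < n → m ≥ 1 → 2 ^ ⌊log₂ m ⌋ ≤ m) → n ≥ 1 → 2 ^ ⌊log₂ n ⌋ ≤ n
  go 1               ih _ = ≤-refl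
  go n@(suc (suc k)) ih _ = begin
    2 ^ ⌊log₂ n ⌋              ≡⟨ cong (2 ^_) (sym log-n) ⟩
    2 * 2 ^ ⌊log₂ ⌊ n /2⌋ ⌋    ≤⟨ *-monoʳ-≤ 2 (ih (⌊n/2⌋<n (suc k)) (s≤s z≤n)) ⟩
    2 * ⌊ n /2⌋                ≡⟨ cong (⌊ n /2⌋ +_) (+-identityʳ ⌊ n /2⌋) ⟩
    ⌊ n /2⌋ + ⌊ n /2⌋          ≤⟨ +-monoʳ-≤ ⌊ n /2⌋ (⌊n/2⌋≤⌈n/2⌉ n) ⟩
    ⌊ n /2⌋ + ⌈ n /2⌉          ≡⟨ ⌊n/2⌋+⌈n/2⌉≡n n ⟩
    n                          ∎
    where
    log-n : suc ⌊log₂ ⌊ n /2⌋ ⌋ ≡ ⌊log₂ n ⌋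
    log-n = trans (cong suc (⌊log₂⌊n/2⌋⌋≡⌊log₂n⌋∸1 n))
                  (m+[n∸m]≡n (⌊log₂⌋-mono-≤ {2} {n} (s≤s (s≤s z≤n))))

<2^[1+⌊log₂⌋] : ∀ n → n < 2 ^ suc ⌊log₂ n ⌋
<2^[1+⌊log₂⌋] n = ≰⇒> λ 2^≤n →
  1+n≰n (≤-trans (≤-reflexive (sym (⌊log₂[2^n]⌋≡n (suc ⌊log₂ n ⌋)))) (⌊log₂⌋-mono-≤ 2^≤n))

-- Realization of runs

bits-< : ∀ x k → x < 2 ^ suc k → bits x ≤ suc k
bits-< zero    k _  = s≤s z≤n
bits-< (suc x) k x< = ≰⇒> λ k<log →
  <-irrefl refl (<-≤-trans x< (≤-trans (^-monoʳ-≤ 2 k<log) (2^⌊log₂⌋≤ (suc x) (s≤s z≤n))))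

-- The sum x + y is below (x + 1)(y + 1), and each factor is at most a power of two whose exponent
-- is the bit-length.
bits-+ : ∀ x y → bits (x + y) ≤ bits x + bits y
bits-+ x y = bits-< (x + y) (⌊log₂ x ⌋ + bits y) (begin
  suc (x + y)               ≤⟨ m≤m+n (suc (x + y)) (x * y) ⟩
  suc (x + y) + x * y       ≡⟨ expand x y ⟩
  suc x * suc y             ≤⟨ *-mono-≤ (<2^[1+⌊log₂⌋] x) (<2^[1+⌊log₂⌋] y) ⟩
  2 ^ bits x * 2 ^ bits y   ≡⟨ sym (^-distribˡ-+-* 2 (bits x) (bits y)) ⟩
  2 ^ (bits x + bits y)     ∎)
  where
  open ≤-Reasoning
  expand : ∀ x y → suc (x + y) + x * y ≡ suc x * suc y
  expand = solve-∀

bits-* : ∀ k x → bits (k * x) ≤ suc (k * bits x)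
bits-* zero    x = s≤s z≤n
bits-* (suc k) x = begin
  bits (x + k * x)               ≤⟨ bits-+ x (k * x) ⟩
  bits x + bits (k * x)          ≤⟨ +-monoʳ-≤ (bits x) (bits-* k x) ⟩
  bits x + suc (k * bits x)      ≡⟨ +-suc (bits x) (k * bits x) ⟩
  suc (bits x + k * bits x)      ∎
  where open ≤-Reasoning

∣⌈⌉∣ : ∀ {n} s → ∣ ⌈_⌉ {n} s ∣ ≡ 4 + 5 * length s
∣⌈⌉∣ []          = refl
∣⌈⌉∣ (b ∷ s) = trans (eq b) (arith (length s))
  where
  eq : ∀ b → ∣ ⌈ b ∷ s ⌉ ∣ ≡ 5 + (4 + 5 * length s)
  eq false = cong (5 +_) (∣⌈⌉∣ s)
  eq true  = cong (5 +_) (∣⌈⌉∣ s)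
  arith : ∀ m → 5 + (4 + 5 * m) ≡ 4 + 5 * suc m
  arith = solve-∀

-- The reduction is deterministic, hence given by a function on the terms that reduce.
reduce : Term 0 → Term 0
reduce (ƛ t · v)         = t [ v ]
reduce (t@(_ · _) · v)   = reduce t · v
reduce t                 = t

reduce-→det : ∀ {t u} → t →det u → reduce t ≡ u
reduce-→det (β _)                                = refl
reduce-→det (argʳ {t = _ · _} r _)               = cong (_· _) (reduce-→det r)

iterate : ℕ → Term 0 → Term 0
iterate zero    t = t
iterate (suc k) t = iterate k (reduce t)

iterate-→det : ∀ k {t u} (σ : Star _→det_ t u) → suc k ≤ steps σ →
               iterate k t →det iterate (suc k) t
iterate-→det zero    {t} (r ◅ σ) _       = subst (t →det_) (sym (reduce-→det r)) r
iterate-→det (suc k) (r ◅ σ) (s≤s k<) rewrite reduce-→det r = iterate-→det k σ k<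

-- By determinism every finite run follows the iterates of `reduce`, so these form an infinite
-- sequence as soon as runs are arbitrarily long.
long-runs⇒Diverges : ∀ {t} → (∀ k → ∃[ u ] ∃ λ (σ : Star _→det_ t u) → k ≤ steps σ) →
                     Diverges _→det_ t
long-runs⇒Diverges {t} long = (λ k → iterate k t) , refl , λ k →
  let _ , σ , k< = long (suc k) in iterate-→det k σ k<

CloRel-intro : ∀ {n o g u r} {t : Term n} {e : Env n} → erase t ≡ ƛ u →
               bits (o + ∣ t ∣) ≤ g → EnvRel e r → CloRel (clo o t e) (clo g u r)
CloRel-intro {t = ƛ t} refl g e = clo g e

StateRel-intro : ∀ {n o g u r π ρ} {t : Term n} {e : Env n} → erase t ≡ u → bits (o + ∣ t ∣) ≤ g →
                 EnvRel e r → Pointwise CloRel π ρ → StateRel ⟪ o , t , e , π ⟫ ⟪ g ∣ u ∣ r ∣ ρ ⟫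
StateRel-intro refl = rel

final-state : ∀ b {s g u r} → u ≡ booleanTerm b → StateRel s ⟪ g ∣ u ∣ r ∣ [] ⟫ →
              ⟦ s ⟧ ≡ ⌈ b ⌉ᵇ × IsNormalForm _→KAM_ s
final-state true  eq (rel {t = ƛ (ƛ (var (suc zero)))} g ρ []) = refl , λ ()
final-state false eq (rel {t = ƛ (ƛ (var zero))} g ρ []) = refl , λ ()

-- The space bound is absolute here, so that it survives the composition of unboundedly many pieces.
PathBetween : ℕ → RawState → ℕ → ℕ → RawState → Set
PathBetween B s lo hi s′ = ∃[ k ] (lo ≤ k × k ≤ hi × Path B s k s′)

bounded : ∀ {s m lo hi s′ B m′} → size s ≤ B → m ≤ m′ → s ⇒⟨ m , lo , hi ⟩ s′ →
          PathBetween (2 ^ m′ * B) s lo hi s′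
bounded s≤ m≤ (mk l h p) = _ , l , h , Path-mono (*-mono-≤ (^-monoʳ-≤ 2 m≤) s≤) p

_+++_ : ∀ {B s l₁ h₁ s′ l₂ h₂ s″} → PathBetween B s l₁ h₁ s′ → PathBetween B s′ l₂ h₂ s″ →
        PathBetween B s (l₁ + l₂) (h₁ + h₂) s″
(_ , l₁ , h₁ , p) +++ (_ , l₂ , h₂ , q) = _ , +-mono-≤ l₁ l₂ , +-mono-≤ h₁ h₂ , Path-++ p q

realize-halting : ∀ {s₀ s₁ r B lo hi b g e t} → s₀ →KAM s₁ → space s₀ ≤ B →
  StateRel s₁ r → ⟦ s₁ ⟧ ≡ t →
  PathBetween B r lo hi ⟪ g ∣ booleanTerm b ∣ e ∣ [] ⟫ →
  ∃ λ (σ : Star _→det_ t ⌈ b ⌉ᵇ) → (lo ≤ steps σ × steps σ ≤ hi) ×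
  (∃ λ s → ∃ λ (κ : Star _→KAM_ s₀ s) → IsNormalForm _→KAM_ s × S-KAM κ ≤ B)
realize-halting {b = b} κ₀ s₀≤ sr refl (_ , lo , hi , p) with realize sr p
... | s , sr′ , (κ , κ≤) , σ , refl with final-state b refl sr′
... | ⟦s⟧ , nf rewrite sym ⟦s⟧ = σ , (lo , hi) , s , κ₀ ◅ κ , nf , ⊔-lub s₀≤ κ≤

realize-prefix : ∀ {s r r′ B k lo hi t} → StateRel s r → ⟦ s ⟧ ≡ t →
                 PathBetween B r lo hi r′ → k ≤ lo →
                 ∃[ u ] ∃ λ (σ : Star _→det_ t u) → k ≤ steps σ
realize-prefix sr refl (_ , lo , hi , p) k≤ with realize sr p
... | _ , _ , _ , σ , refl = _ , σ , ≤-trans k≤ lo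

-- Correctness of the programs

-- K bounds the lengths of the addresses in the machine, and J in the input.
module Simulation (K J : ℕ) where

  ptr : List Bool → RawClosure
  ptr s = val J (str s)

  comp : List Bool → List Bool → RawClosure → List RawClosure → RawState
  comp a p k π = enter (val K COMP) (val K COMP ∷ ptr a ∷ ptr p ∷ k ∷ π)

  str-∷-⇒′ : ∀ b s {c cε π} → enter (ptr (b ∷ s)) (c ∷ c ∷ cε ∷ π) ⇒⟨ 5 , 3 , 3 ⟩
             enter c (ptr s ∷ π)
  str-∷-⇒′ true  s = str-∷-⇒ true s
  str-∷-⇒′ false s = str-∷-⇒ false s

  -- Here and below, exponents count transitions of the machine and the two bounds count β-steps;
  -- `relax` brings the cases to common values.
  comp-step : ∀ a b p k π → comp a (b ∷ p) k π ⇒⟨ 33 , 1 , 14 ⟩ comp (drop 1 a) p k π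
  comp-step []      b p k π = relax (m≤n+m 31 2) (m≤n+m 1 12) (m≤n+m 13 1)
    (compute 9 refl ⨾ str-∷-⇒′ b p ⨾ compute 17 refl)
  comp-step (c ∷ a) b p k π = relax ≤-refl (m≤n+m 1 13) ≤-refl
    (compute 9 refl ⨾ str-∷-⇒′ b p ⨾ compute 7 refl ⨾ str-∷-⇒′ c a ⨾ compute 7 refl)

  comp-⇒ : ∀ a p k π → comp a p k π ⇒⟨ 33 , length p , 14 * length p + 7 ⟩
           enter k (ptr (drop (length p) a) ∷ π)
  comp-⇒ a []      k π = relax (m≤n+m 13 20) z≤n ≤-refl (compute 13 refl)
  comp-⇒ a (b ∷ p) k π =
    subst (λ s → comp a (b ∷ p) k π ⇒⟨ 33 , suc (length p) , 14 * suc (length p) + 7 ⟩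
                 enter k (ptr s ∷ π))
          (drop-drop 1 (length p) a)
          (relax ≤-refl ≤-refl (≤-reflexive (arith (length p)))
            -- All pointers into the input have size `J`, so each iteration starts from a state of
            -- the same size and the exponent does not grow.
            (loop (comp-step a b p k π) ≤-refl (comp-⇒ (drop 1 a) p k π)))
    where
    arith : ∀ n → 14 + (14 * n + 7) ≡ 14 * suc n + 7
    arith = solve-∀

  pad : List Bool → List Bool → RawClosure → List RawClosure → RawState
  pad i p k π = enter (val K PAD) (val K PAD ∷ ptr i ∷ ptr p ∷ k ∷ π)

  pad-once : ∀ i b p k π → let q = drop (length (b ∷ p)) i in
             pad i (b ∷ p) k π ⇒⟨ 95 , length (b ∷ p) + length q ,
                                       14 * (length (b ∷ p) + length q) + 24 ⟩
             pad i (drop (length q) p) k π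
  pad-once i b p k π = relax ≤-refl lo (≤-reflexive (hi (length (b ∷ p)) (length q)))
    (compute 8 refl ⨾ str-∷-⇒′ b p ⨾ compute 5 refl ⨾ comp-⇒ i (b ∷ p) _ _ ⨾
     compute 5 refl ⨾ comp-⇒ p q _ _ ⨾ compute 6 refl)
    where
    q = drop (length (b ∷ p)) i
    hi : ∀ m n → 4 + (3 + (1 + ((14 * m + 7) + (1 + ((14 * n + 7) + 1))))) ≡ 14 * (m + n) + 24
    hi = solve-∀
    lo′ : ∀ m n → 4 + (3 + (1 + (m + (1 + (n + 1))))) ≡ 10 + (m + n)
    lo′ = solve-∀
    lo : length (b ∷ p) + length q ≤ 4 + (3 + (1 + (length (b ∷ p) + (1 + (length q + 1)))))
    lo = ≤-trans (m≤n+m _ 10) (≤-reflexive (sym (lo′ (length (b ∷ p)) (length q))))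

  pad-step : ∀ i d k π → d < length i →
             pad i (drop d i) k π ⇒⟨ 95 , length i , 14 * length i + 24 ⟩
             pad i (drop (suc (d + d)) i) k π
  pad-step i d k π d<n with drop d i in eq | length-drop d i
  ... | []    | len = ⊥-elim (<-irrefl len (m<n⇒0<n∸m d<n))
  ... | b ∷ p | len = subst₂ (λ n p′ → pad i (b ∷ p) k π ⇒⟨ 95 , n , 14 * n + 24 ⟩ pad i p′ k π)
    total reached (pad-once i b p k π)
    where
    q = drop (length (b ∷ p)) i
    length-q : length q ≡ d
    length-q = trans (length-drop (length (b ∷ p)) i)
      (trans (cong (length i ∸_) len) (m∸[m∸n]≡n (<⇒≤ d<n)))
    total : length (b ∷ p) + length q ≡ length i
    total = trans (cong₂ _+_ len length-q) (m∸n+n≡m (<⇒≤ d<n))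
    reached : drop (length q) p ≡ drop (suc (d + d)) i
    reached = trans (cong (λ m → drop m p) length-q)
      (trans (cong (λ s → drop (suc d) s) (sym eq))
        (trans (drop-drop d (suc d) i) (cong (λ m → drop m i) (+-suc d d))))

  -- The offset d goes through 0, 1, 3, 7, …: its successor doubles.
  pad-rounds : ∀ i N d k π → length i < 2 ^ N * suc d →
               (∀ S → N ≡ suc S → 2 ^ S * suc d ≤ length i) →
               pad i (drop d i) k π ⇒⟨ 95 , N * length i , N * (14 * length i + 24) + 7 ⟩
               enter k π
  pad-rounds i zero d k π n< _
    -- With no round left, the offset has reached the end and the suffix is empty.
    rewrite drop-all d i (≤-pred (≤-trans n< (≤-reflexive (*-identityˡ (suc d))))) =
    relax (m≤n+m 12 83) z≤n ≤-refl (compute 12 refl)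
  pad-rounds i (suc N) d k π n< ≤n =
    relax ≤-refl ≤-refl
      (≤-reflexive (sym (+-assoc (14 * length i + 24) (N * (14 * length i + 24)) 7)))
      (loop (pad-step i d k π d<n) ≤-refl (pad-rounds i N (suc (d + d)) k π
        (subst (length i <_) (doubling N) n<) λ where
          S refl → ≤-trans (≤-reflexive (sym (doubling S))) (≤n (suc S) refl)))
    where
    d<n : d < length i
    d<n = ≤-trans (m≤n*m (suc d) (2 ^ N) {{m^n≢0 2 N}}) (≤n N refl)
    doubling : ∀ S → 2 ^ suc S * suc d ≡ 2 ^ S * suc (suc (d + d))
    doubling S = trans (cong (_* suc d) (*-comm 2 (2 ^ S)))
      (trans (*-assoc (2 ^ S) 2 (suc d)) (cong (2 ^ S *_) (two d)))
      where
      two : ∀ d → 2 * suc d ≡ suc (suc (d + d))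
      two = solve-∀

  pad-⇒ : ∀ i k π → pad i i k π ⇒⟨ 95 , ⌊log₂ length i ⌋ * length i ,
                                        suc ⌊log₂ length i ⌋ * (14 * length i + 24) + 7 ⟩
          enter k π
  -- The logarithm of 0 defaults to 0 and no round is made; the upper bound has room for one.
  pad-⇒ []        k π = relax (m≤n+m 12 83) z≤n (m≤n+m 7 24) (compute 12 refl)
  pad-⇒ i@(_ ∷ _) k π = relax ≤-refl (m≤n+m _ (length i)) ≤-refl
    (pad-rounds i (suc ⌊log₂ length i ⌋) 0 k π
      (subst (length i <_) (sym (*-identityʳ _)) (<2^[1+⌊log₂⌋] (length i))) λ where
        S refl → subst (_≤ length i) (sym (*-identityʳ _)) (2^⌊log₂⌋≤ (length i) (s≤s z≤n)))

  -- A cell costs the address of its code and that of one binder, so the space is linear in the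
  -- number of cells.
  tapeClo : List WorkSym → RawClosure
  tapeClo []      = val K NIL
  tapeClo (a ∷ l) = clo K (bodyOf (cell a var)) (just (K , tapeClo l) ∷ [])

  cons-⇒ : ∀ a k l π → enter (val K (CONS a)) (k ∷ tapeClo l ∷ π) ⇒⟨ 4 , 2 , 2 ⟩
           enter k (tapeClo (a ∷ l) ∷ π)
  cons-⇒ (bit false) k l π = compute 4 refl
  cons-⇒ (bit true)  k l π = compute 4 refl
  cons-⇒ □           k l π = compute 4 refl

  leftClo rightClo : WorkTape → RawClosure
  leftClo  (tape ls a rs) = tapeClo ls
  rightClo (tape ls a rs) = tapeClo (a ∷ rs)

  work-⇒ : ∀ m a ls rs {h} k π → let w = moveWork m (write a (tape ls h rs)) in
           enter (val K (WORK m)) (val K (CONS a) ∷ k ∷ tapeClo ls ∷ tapeClo rs ∷ π)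
             ⇒⟨ 29 , 0 , 13 ⟩
           enter k (leftClo w ∷ rightClo w ∷ π)
  work-⇒ stay a ls rs k π = relax (m≤n+m 15 14) z≤n (m≤n+m 7 6)
    (compute 7 refl ⨾ cons-⇒ a _ rs π ⨾ compute 4 refl)
  work-⇒ left a [] rs k π = relax (m≤n+m 27 2) z≤n (m≤n+m 12 1)
    (compute 7 refl ⨾ cons-⇒ a _ rs π ⨾ compute 16 refl)
  work-⇒ left a (bit false ∷ ls) rs k π = relax ≤-refl z≤n ≤-refl
    (compute 7 refl ⨾ cons-⇒ a _ rs π ⨾ compute 18 refl)
  work-⇒ left a (bit true ∷ ls) rs k π = relax ≤-refl z≤n ≤-refl
    (compute 7 refl ⨾ cons-⇒ a _ rs π ⨾ compute 18 refl)
  work-⇒ left a (□ ∷ ls) rs k π = relax ≤-refl z≤n ≤-refl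
    (compute 7 refl ⨾ cons-⇒ a _ rs π ⨾ compute 18 refl)
  work-⇒ right a ls [] k π = relax ≤-refl z≤n ≤-refl
    (compute 7 refl ⨾ cons-⇒ a _ ls π ⨾ compute 18 refl)
  work-⇒ right a ls (bit false ∷ rs) k π = relax ≤-refl z≤n ≤-refl
    (compute 7 refl ⨾ cons-⇒ a _ ls π ⨾ compute 18 refl)
  work-⇒ right a ls (bit true ∷ rs) k π = relax ≤-refl z≤n ≤-refl
    (compute 7 refl ⨾ cons-⇒ a _ ls π ⨾ compute 18 refl)
  work-⇒ right a ls (□ ∷ rs) k π = relax ≤-refl z≤n ≤-refl
    (compute 7 refl ⨾ cons-⇒ a _ ls π ⨾ compute 18 refl)

  read-⇒ : ∀ p k π → enter (val K READ) (ptr p ∷ k ∷ π) ⇒⟨ 19 , 0 , 8 ⟩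
           enter k (val K (SYM (symOf p)) ∷ ptr p ∷ π)
  read-⇒ []          k π = relax (m≤n+m 12 7) z≤n (m≤n+m 5 3) (compute 12 refl)
  read-⇒ (false ∷ p) k π = relax ≤-refl z≤n ≤-refl
    (compute 8 refl ⨾ str-∷-⇒ false p ⨾ compute 6 refl)
  read-⇒ (true ∷ p)  k π = relax ≤-refl z≤n ≤-refl
    (compute 8 refl ⨾ str-∷-⇒ true p ⨾ compute 6 refl)

  reread-⇒ : ∀ i p k π → enter (val K REREAD) (ptr i ∷ ptr p ∷ k ∷ π) ⇒⟨ 24 , 0 , 11 ⟩
             enter k (val K (SYM (symOf p)) ∷ ptr p ∷ π)
  reread-⇒ i p k π = relax ≤-refl z≤n ≤-refl (compute 5 refl ⨾ read-⇒ p k π)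

  next-⇒ : ∀ i b p k π → enter (val K NEXT) (ptr i ∷ ptr (b ∷ p) ∷ k ∷ π) ⇒⟨ 34 , 0 , 15 ⟩
           enter k (val K (SYM (symOf p)) ∷ ptr p ∷ π)
  next-⇒ i b p k π = relax ≤-refl z≤n ≤-refl
    (compute 7 refl ⨾ str-∷-⇒′ b p ⨾ compute 3 refl ⨾ read-⇒ p k π)

  comp-to-⇒ : ∀ a p {s} k π → drop (length p) a ≡ s →
              comp a p k π ⇒⟨ 33 , length p , 14 * length p + 7 ⟩ enter k (ptr s ∷ π)
  comp-to-⇒ a p k π refl = comp-⇒ a p k π

  back-L-⇒ : ∀ i k π → enter (val K BACK) (ptr i ∷ ptr i ∷ k ∷ π) ⇒⟨ 51 , 0 , 14 * length i + 14 ⟩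
             enter k (val K (SYM L) ∷ ptr i ∷ π)
  back-L-⇒ i k π = relax ≤-refl z≤n (≤-reflexive (arith (length i)))
    (compute 7 refl ⨾
     comp-to-⇒ i i _ π (drop-all (length i) i ≤-refl) ⨾
     compute 11 refl)
    where
    arith : ∀ n → 3 + (14 * n + 7 + 4) ≡ 14 * n + 14
    arith = solve-∀

  back-⇒ : ∀ i d k π → suc d ≤ length i →
           enter (val K BACK) (ptr i ∷ ptr (drop (suc d) i) ∷ k ∷ π)
             ⇒⟨ 114 , 0 , 28 * length i + 33 ⟩
           enter k (val K (SYM (symOf (drop d i))) ∷ ptr (drop d i) ∷ π)
  -- The result of the first walk is generalized for case analysis; its length `suc d` excludes the
  -- empty string.
  back-⇒ i d k π d<n = go (drop (length p) i) refl
    where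
    p = drop (suc d) i
    length-q : length (drop (length p) i) ≡ suc d
    length-q = trans (length-drop (length p) i)
      (trans (cong (length i ∸_) (length-drop (suc d) i)) (m∸[m∸n]≡n d<n))
    arith : ∀ n → 3 + (14 * n + 7 + (1 + (3 + (3 + (14 * n + 7 + (1 + 8)))))) ≡ 28 * n + 33
    arith = solve-∀
    p≤n : length p ≤ length i
    p≤n = subst (_≤ length i) (sym (length-drop (suc d) i)) (m∸n≤m (length i) (suc d))
    go : ∀ q → drop (length p) i ≡ q →
         enter (val K BACK) (ptr i ∷ ptr p ∷ k ∷ π) ⇒⟨ 114 , 0 , 28 * length i + 33 ⟩
         enter k (val K (SYM (symOf (drop d i))) ∷ ptr (drop d i) ∷ π)
    go []      eq with () ← trans (sym (cong length eq)) length-q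
    go (b ∷ q) eq = relax ≤-refl z≤n
      (≤-trans (+-mono-≤ (≤-refl {3}) (+-mono-≤ (+-monoˡ-≤ 7 (*-monoʳ-≤ 14 p≤n))
                 (+-monoʳ-≤ 7 (+-monoˡ-≤ 9 (+-monoˡ-≤ 7 (*-monoʳ-≤ 14 q≤n))))))
               (≤-reflexive (arith (length i))))
      (compute 7 refl ⨾
       comp-to-⇒ i p _ π eq ⨾
       compute 7 refl ⨾ str-∷-⇒′ b q ⨾ compute 7 refl ⨾
       comp-to-⇒ i q _ π (cong (λ m → drop m i) q≡d) ⨾
       compute 3 refl ⨾ read-⇒ (drop d i) k π)
      where
      q≡d : length q ≡ d
      q≡d = suc-injective (trans (sym (cong length eq)) length-q)
      q≤n : length q ≤ length i
      q≤n = subst (_≤ length i) (sym q≡d) (≤-trans (n≤1+n d) d<n)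

  inside-⇒ : ∀ i m (k : Fin (suc (length i))) {p′} → MoveInput m (suc k) p′ → ∀ c π →
             enter (val K (fromInside m)) (ptr i ∷ ptr (drop (toℕ k) i) ∷ c ∷ π)
               ⇒⟨ 114 , 0 , 28 * length i + 33 ⟩
             enter c (val K (SYM (lookup (inputTape i) p′)) ∷ ptr (suffix i p′) ∷ π)
  inside-⇒ i left k {zero} (left eq) c π rewrite suc-injective eq =
    relax (m≤n+m 51 63) z≤n (+-mono-≤ (*-monoˡ-≤ (length i) (m≤n+m 14 14)) (m≤n+m 14 19))
      (back-L-⇒ i c π)
  inside-⇒ i left k {suc k′} (left eq) c π rewrite suc-injective eq | lookup-suffix i k′ =
    back-⇒ i (toℕ k′) c π (≤-pred (subst (_< suc (length i)) (suc-injective eq) (toℕ<n k)))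
  inside-⇒ i stay k stay c π rewrite lookup-suffix i k =
    relax (m≤n+m 24 90) z≤n (≤-trans (m≤n+m 11 22) (m≤n+m 33 (28 * length i)))
      (reread-⇒ i (drop (toℕ k) i) c π)
  inside-⇒ i right k {suc k′} (right eq) c π
    with drop-< i (toℕ k) (≤-pred (subst (_< suc (length i)) (suc-injective eq) (toℕ<n k′)))
  ... | b , eq′ rewrite lookup-suffix i k′ | suc-injective eq | eq′ =
    relax (m≤n+m 34 80) z≤n (≤-trans (m≤n+m 15 18) (m≤n+m 33 (28 * length i)))
      (next-⇒ i b (drop (suc (toℕ k)) i) c π)

  input-⇒ : ∀ i m p {p′} → MoveInput m p p′ → ∀ c π →
            enter (val K (INPUT (lookup (inputTape i) p) m)) (ptr i ∷ ptr (suffix i p) ∷ c ∷ π)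
              ⇒⟨ 114 , 0 , 28 * length i + 33 ⟩
            enter c (val K (SYM (lookup (inputTape i) p′)) ∷ ptr (suffix i p′) ∷ π)
  input-⇒ i m (suc k) mv c π rewrite lookup-suffix i k | INPUT-symOf (drop (toℕ k) i) m =
    inside-⇒ i m k mv c π
  input-⇒ i stay zero stay c π =
    relax (m≤n+m 6 108) z≤n (≤-trans (m≤n+m 3 30) (m≤n+m 33 (28 * length i))) (compute 6 refl)
  input-⇒ i right zero {suc zero} (right eq) c π rewrite lookup-suffix i zero =
    relax (m≤n+m 24 90) z≤n (≤-trans (m≤n+m 11 22) (m≤n+m 33 (28 * length i))) (reread-⇒ i i c π)
  input-⇒ i right zero {suc (suc _)} (right ()) c π

  -- Each skipped row costs 23 transitions and 10 β-steps, so the total depends only on the machine.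
  select-⇒ : ∀ {n} (rows : Fin n → Comb) q π →
             enter (val K (SEL (toℕ q))) (val K (TABLE rows) ∷ π) ⇒⟨ 23 * n , 0 , 10 * n ⟩
             enter (val K (rows q)) π
  select-⇒ {suc n} rows zero π =
    relax (≤-trans (m≤n+m 18 5) (m≤m*n 23 (suc n))) z≤n
          (≤-trans (m≤n+m 8 2) (m≤m*n 10 (suc n)))
      (compute 3 refl ⨾ glue-⇒ (glue PAIR (rows zero)) (TABLE (rows ∘ suc)) ⨾
       glue-⇒ PAIR (rows zero) ⨾ compute 9 refl)
  select-⇒ {suc n} rows (suc q) π =
    relax (≤-reflexive (sym (*-suc 23 n))) z≤n (≤-reflexive (sym (*-suc 10 n)))
      (glue-⇒ SKIP (SEL (toℕ q)) ⨾ compute 4 refl ⨾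
       glue-⇒ (glue PAIR (rows zero)) (TABLE (rows ∘ suc)) ⨾
       glue-⇒ PAIR (rows zero) ⨾ compute 10 refl ⨾ select-⇒ (rows ∘ suc) q π)

  sym-⇒ : ∀ (e : InputSym → Comb) s π →
          enter (val K (SYM s))
            (val K (e (bit false)) ∷ val K (e (bit true)) ∷ val K (e L) ∷ val K (e R) ∷ π)
            ⇒⟨ 5 , 4 , 4 ⟩ enter (val K (e s)) π
  sym-⇒ e (bit false) π = compute 5 refl
  sym-⇒ e (bit true)  π = compute 5 refl
  sym-⇒ e L           π = compute 5 refl
  sym-⇒ e R           π = compute 5 refl

  cell-⇒ : ∀ (e : WorkSym → Comb) a l {d} π →
           enter (tapeClo (a ∷ l))
             (val K (e (bit false)) ∷ val K (e (bit true)) ∷ val K (e □) ∷ d ∷ π)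
             ⇒⟨ 6 , 4 , 4 ⟩ enter (val K (e a)) (tapeClo l ∷ π)
  cell-⇒ e (bit false) l π = compute 6 refl
  cell-⇒ e (bit true)  l π = compute 6 refl
  cell-⇒ e □           l π = compute 6 refl

  -- Simulation of the runs of a machine

  module Main (M : TM) (i : List Bool) where

    open TM M
    open Encoding M

    n l : ℕ
    n = length i
    l = ⌊log₂ length i ⌋

    main : Config M i → RawState
    main (config q p w) =
      enter (val K RUN) (val K RUN ∷ ptr i ∷ val K (SEL (toℕ q)) ∷
        val K (SYM (lookup (inputTape i) p)) ∷ ptr (suffix i p) ∷ leftClo w ∷ rightClo w ∷ [])

    dispatch-⇒ : ∀ q s a {p ls} rs π →
                 enter (val K (row q)) (val K (SYM s) ∷ p ∷ ls ∷ tapeClo (a ∷ rs) ∷ π) ⇒⟨ 55 , 0 , 26 ⟩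
                 enter (val K (entry q s a)) (tapeClo rs ∷ p ∷ ls ∷ π)
    dispatch-⇒ q s a {p} {ls} rs π = relax ≤-refl z≤n ≤-refl
      (glue-⇒ (glue₃ SWITCH-SYM (cells-row q (bit false)) (cells-row q (bit true)) (cells-row q L))
              (cells-row q R) ⨾
       glue₃-⇒ SWITCH-SYM (cells-row q (bit false)) (cells-row q (bit true)) (cells-row q L) ⨾
       compute 10 refl ⨾ sym-⇒ (cells-row q) s _ ⨾
       glue₃-⇒ SWITCH-CELL (entry q s (bit false)) (entry q s (bit true)) (entry q s □) ⨾
       compute 13 refl ⨾ cell-⇒ (entry q s) a rs _)

    -- The lower bound comes from the padding. The additional 1 keeps every transition at a positive
    -- cost even when `l * n` is 0, as divergence requires.
    entry-⇒ : ∀ q p ls a rs → let s = lookup (inputTape i) p in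
              main (config q p (tape ls a rs))
                ⇒⟨ 3 + (19 + (95 + (23 * states + 55))) , 1 + l * n ,
                   1 + (8 + ((suc l * (14 * n + 24) + 7) + (10 * states + 26))) ⟩
              enter (val K (entry q s a))
                (tapeClo rs ∷ ptr (suffix i p) ∷ tapeClo ls ∷ val K RUN ∷ ptr i ∷ [])
    entry-⇒ q p ls a rs = relax ≤-refl (s≤s (m≤n⇒m≤o+n 8 (m≤m+n (l * n) 0))) ≤-refl
      (glue-⇒ LOOP (TABLE row) ⨾ compute 19 refl ⨾ pad-⇒ i _ _ ⨾
       select-⇒ row q _ ⨾ dispatch-⇒ q (lookup (inputTape i) p) a rs _)

    act-just-⇒ : ∀ q a mi mw q′ p {p′} ls h rs → MoveInput mi p p′ →
                 let s = lookup (inputTape i) p in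
                 enter (val K (act q s (just (a , mi , mw , q′))))
                   (tapeClo rs ∷ ptr (suffix i p) ∷ tapeClo ls ∷ val K RUN ∷ ptr i ∷ [])
                   ⇒⟨ 185 , 0 , 13 + ((28 * n + 33) + 17) ⟩
                 main (config q′ p′ (moveWork mw (write a (tape ls h rs))))
    act-just-⇒ q a mi mw q′ p ls h rs mv = relax ≤-refl z≤n ≤-refl
      (glue-⇒ (glue₃ STEP (INPUT s mi) (WORK mw) (CONS a)) (SEL (toℕ q′)) ⨾
       glue₃-⇒ STEP (INPUT s mi) (WORK mw) (CONS a) ⨾
       compute 13 refl ⨾ input-⇒ i mi p mv _ _ ⨾
       compute 7 refl ⨾ work-⇒ mw a ls rs {h} _ _ ⨾ compute 10 refl)
      where s = lookup (inputTape i) p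

    private
      hi-sum : ∀ x n k → 1 + (8 + ((x + 7) + (10 * k + 26))) + (13 + ((28 * n + 33) + 17)) ≡
                         x + (28 * n + (105 + 10 * k))
      hi-sum = solve-∀

      exp-sum : ∀ k → 3 + (19 + (95 + (23 * k + 55))) + 185 ≡ 357 + 23 * k
      exp-sum = solve-∀

    -- Transitions and halting share the padding and the dispatch; they differ only in the value `m`
    -- of the transition function.
    from-entry : ∀ q p ls a rs {m s} → (let c = lookup (inputTape i) p in
                 enter (val K (act q c m))
                   (tapeClo rs ∷ ptr (suffix i p) ∷ tapeClo ls ∷ val K RUN ∷ ptr i ∷ [])
                   ⇒⟨ 185 , 0 , 13 + ((28 * n + 33) + 17) ⟩ s) →
                 δ q (lookup (inputTape i) p) a ≡ m →
                 main (config q p (tape ls a rs)) ⇒⟨ expʳ , 1 + l * n , hiʳ n l ⟩ s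
    from-entry q p ls a rs acts refl =
      relax (≤-reflexive (trans (exp-sum states) (sym expʳ-≡)))
            (m≤m+n _ 0)
            (≤-trans (≤-reflexive (hi-sum (suc l * (14 * n + 24)) n states))
              (+-monoʳ-≤ (suc l * (14 * n + 24)) (+-monoʳ-≤ (28 * n)
                (+-monoˡ-≤ (10 * states) (m≤n+m 105 45)))))
        (entry-⇒ q p ls a rs ⨾ acts)

    step-⇒ : ∀ {C C′} → _⟶TM_ M i C C′ → main C ⇒⟨ expʳ , 1 + l * n , hiʳ n l ⟩ main C′
    step-⇒ {config q p (tape ls h rs)} (step {a = a} {mi} {mw} {q′} eq mv) =
      from-entry q p ls h rs (act-just-⇒ q a mi mw q′ p ls h rs mv) eq

    does-final : ∀ b → does (final b ≟ final true) ≡ b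
    does-final true  = dec-true (final true ≟ final true) refl
    does-final false = dec-false (final false ≟ final true) q₀≢q₁

    HALT-⇒ : ∀ b {c₁ c₂ c₃ c₄ c₅} → enter (val K (HALT b)) (c₁ ∷ c₂ ∷ c₃ ∷ c₄ ∷ c₅ ∷ []) ⇒⟨ 5 , 5 , 5 ⟩
             ⟪ K ∣ booleanTerm b ∣ replicate 5 nothing ∣ [] ⟫
    HALT-⇒ true  = compute 5 refl
    HALT-⇒ false = compute 5 refl

    -- Halting is found out after one more padding, which accounts for the + 1 in the time bound.
    halt-⇒ : ∀ b p w → main (config (final b) p w) ⇒⟨ expʳ , 1 + l * n , hiʳ n l ⟩
             ⟪ K ∣ booleanTerm b ∣ replicate 5 nothing ∣ [] ⟫
    halt-⇒ b p (tape ls a rs) =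
      from-entry (final b) p ls a rs
        (relax (m≤n+m 5 180) z≤n (s≤s (s≤s (s≤s (s≤s (s≤s z≤n)))))
          (subst (λ d → enter (val K (HALT d)) _ ⇒⟨ 5 , 5 , 5 ⟩ _)
                 (sym (does-final b)) (HALT-⇒ b)))
        (halts b _ a)

    start-⇒ : enter (val K MACHINE) (ptr i ∷ []) ⇒⟨ 19 , 6 , 6 ⟩ main (initial M i)
    start-⇒ = glue-⇒ (glue START RUN) (SEL (toℕ start)) ⨾ glue-⇒ START RUN ⨾ compute 13 refl

    sizeBound : ℕ → ℕ
    sizeBound S = 2 * J + 6 * K + S * (2 * K)

    cloSize-tape : ∀ l → cloSize (tapeClo l) ≡ K + length l * (2 * K)
    cloSize-tape []      = refl
    cloSize-tape (_ ∷ l) =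
      trans (cong (λ s → K + (K + s + 0)) (cloSize-tape l)) (arith K (length l))
      where
      arith : ∀ K m → K + (K + (K + m * (2 * K)) + 0) ≡ K + suc m * (2 * K)
      arith = solve-∀

    size-main : ∀ C → size (main C) ≡ sizeBound (cells C)
    size-main (config q p (tape ls a rs))
      rewrite cloSize-tape ls | cloSize-tape (a ∷ rs) = arith K J (length ls) (length rs)
      where
      arith : ∀ K J m k → K + 0 + (K + 0 + (J + 0 + (K + 0 + (K + 0 + (J + 0 +
                (K + m * (2 * K) + (K + suc k * (2 * K) + 0))))))) ≡
              2 * J + 6 * K + (m + 1 + k) * (2 * K)
      arith = solve-∀

    sizeBound-mono : ∀ {S S′} → S ≤ S′ → sizeBound S ≤ sizeBound S′
    sizeBound-mono S≤ = +-monoʳ-≤ (2 * J + 6 * K) (*-monoˡ-≤ (2 * K) S≤)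

    main-≤ : ∀ {S} C → cells C ≤ S → size (main C) ≤ sizeBound S
    main-≤ C C≤ = ≤-trans (≤-reflexive (size-main C)) (sizeBound-mono C≤)

    peak≥first : ∀ {C C′} (ρ : Star (_⟶TM_ M i) C C′) → cells C ≤ peak cells ρ
    peak≥first ε       = ≤-refl
    peak≥first (_ ◅ ρ) = m≤m⊔n _ _

    peak≥last : ∀ {C C′} (ρ : Star (_⟶TM_ M i) C C′) → cells C′ ≤ peak cells ρ
    peak≥last ε       = ≤-refl
    peak≥last (_ ◅ ρ) = ≤-trans (peak≥last ρ) (m≤n⊔m _ _)

    -- Each simulated transition starts from a state of size at most `sizeBound S`, so the factor
    -- `2 ^ expʳ` is paid once and not once per transition.
    steps-path : ∀ {C C′} (ρ : Star (_⟶TM_ M i) C C′) S → peak cells ρ ≤ S →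
                 PathBetween (2 ^ expʳ * sizeBound S) (main C)
                   (steps ρ * suc (l * n)) (steps ρ * hiʳ n l) (main C′)
    steps-path {C} ε S C≤ = 0 , z≤n , z≤n ,
      done (≤-trans (main-≤ C C≤) (m≤n*m _ (2 ^ expʳ) {{m^n≢0 2 expʳ}}))
    steps-path {C} (r ◅ ρ) S ρ≤ =
      bounded (main-≤ C (≤-trans (m≤m⊔n _ _) ρ≤)) ≤-refl (step-⇒ r)
        +++ steps-path ρ S (≤-trans (m≤n⊔m _ _) ρ≤)

    run-path-from-start : ∀ {C} (ρ : Run M i C) →
      PathBetween (2 ^ expʳ * sizeBound (S-TM ρ)) (enter (val K MACHINE) (ptr i ∷ []))
        (6 + T-TM ρ * suc (l * n)) (6 + T-TM ρ * hiʳ n l) (main C)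
    run-path-from-start ρ =
      bounded start-≤ (≤-trans (m≤n⇒m≤o+n 338 (m≤m+n 19 (23 * states)))
                               (≤-reflexive (sym expʳ-≡))) start-⇒
        +++ steps-path ρ (S-TM ρ) ≤-refl
      where
      start-≤ : size (enter (val K MACHINE) (ptr i ∷ [])) ≤ sizeBound (S-TM ρ)
      start-≤ = ≤-trans (≤-trans (m≤m+n _ (J + 5 * K)) (≤-reflexive (arith K J)))
                        (m≤m+n _ (S-TM ρ * (2 * K)))
        where
        arith : ∀ K J → K + 0 + (J + 0 + 0) + (J + 5 * K) ≡ 2 * J + 6 * K
        arith = solve-∀

    halting-path : ∀ {C} b → Config.state C ≡ final b → (ρ : Run M i C) →
      PathBetween (2 ^ expʳ * sizeBound (S-TM ρ)) (enter (val K MACHINE) (ptr i ∷ []))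
        (6 + T-TM ρ * suc (l * n) + suc (l * n)) (6 + T-TM ρ * hiʳ n l + hiʳ n l)
        ⟪ K ∣ booleanTerm b ∣ replicate 5 nothing ∣ [] ⟫
    halting-path {config _ p w} b refl ρ =
      run-path-from-start ρ +++
      bounded (main-≤ (config (final b) p w) (peak≥last ρ)) ≤-refl (halt-⇒ b p w)

-- Time and space

-- The code stays opaque: only its erasure and its membership in the fragment are used.
abstract
  machine : (M : TM) → ∃ λ (t : Term 0) → erase t ≡ term (Encoding.MACHINE M) × Det t
  machine M = toTerm 0 (term (Encoding.MACHINE M)) (ok (Encoding.MACHINE M))

encode : TM → Term 0
encode M = proj₁ (machine M)

⌈⌉-¬var : ∀ {n} i → ¬ IsVar (⌈_⌉ {n} i)
⌈⌉-¬var []          ()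
⌈⌉-¬var (false ∷ _) ()
⌈⌉-¬var (true ∷ _)  ()

timeConst : TM → ℕ
timeConst M = 236 + 10 * TM.states M

codeBits machineBits : TM → ℕ
codeBits M    = bits (1 + ∣ encode M ∣)
machineBits M = bits (6 + ∣ encode M ∣)

spaceConst : TM → ℕ
spaceConst M = 2 ^ Encoding.expʳ M * (2 * machineBits M + 22 + 8 * codeBits M)

-- After writing n as m + 2 and l as j + 1, the difference of the two sides is a polynomial with
-- natural coefficients, the one added in `arith`.
hi-≤ : ∀ M T {n l} → 2 ≤ n → 1 ≤ l →
       6 + T * Encoding.hiʳ M n l + Encoding.hiʳ M n l ≤ timeConst M * ((T + 1) * n * l)
hi-≤ M T (s≤s (s≤s (z≤n {m}))) (s≤s (z≤n {j})) =
  ≤-trans (m≤m+n _ _) (≤-reflexive (arith T m j (TM.states M)))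
  where
  arith : ∀ T m j k → let n = suc (suc m); l = suc j
                          h = suc l * (14 * n + 24) + (28 * n + (150 + 10 * k)) in
    6 + T * h + h +
      (222 * T * j * m + 180 * T * m + 420 * T * j + 162 * T + 222 * j * m + 180 * m + 420 * j +
       156 + 10 * T * j * k * m + 10 * T * k * m + 20 * T * j * k + 10 * T * k +
       10 * j * k * m + 10 * k * m + 20 * j * k + 10 * k) ≡
    (236 + 10 * k) * ((T + 1) * n * l)
  arith = solve-∀

lo-≤ : ∀ T n l → (T + 1) * n * l ≤ 6 + T * suc (l * n) + suc (l * n)
lo-≤ T n l = ≤-trans (m≤m+n _ (7 + T)) (≤-reflexive (arith T n l))
  where
  arith : ∀ T n l → (T + 1) * n * l + (7 + T) ≡ 6 + T * suc (l * n) + suc (l * n)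
  arith = solve-∀

module Input (M : TM) (i : List Bool) where

  open Encoding M

  -- In the in-order enumeration the machine comes first, then the root application, then the input
  -- from index `2 + ∣ encode M ∣` on. Thus `K` depends on the machine only.
  K J : ℕ
  K = codeBits M
  J = bits (suc (1 + ∣ encode M ∣) + ∣ ⌈_⌉ {0} i ∣)

  open Simulation K J
  open Main M i

  loaded : State
  loaded = ⟪ 1 , encode M , ∅ , clo (suc (1 + ∣ encode M ∣)) ⌈ i ⌉ ∅ ∷ [] ⟫

  loaded-rel : StateRel loaded (enter (val K MACHINE) (ptr i ∷ []))
  loaded-rel = StateRel-intro (proj₁ (proj₂ (machine M))) ≤-refl nil
    (CloRel-intro (erase-⌈⌉ i) ≤-refl nil ∷ [])

  ⟦loaded⟧ : ⟦ loaded ⟧ ≡ encode M · ⌈ i ⌉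
  ⟦loaded⟧ = cong₂ _·_ (id-vanishes (encode M)) (id-vanishes ⌈ i ⌉)

  load-→KAM : load (encode M · ⌈ i ⌉) →KAM loaded
  load-→KAM = app (⌈⌉-¬var i)

  J≤ : J ≤ machineBits M + (6 + 5 * ⌊log₂ length i ⌋)
  J≤ = begin
    J
      ≡⟨ cong bits (cong (2 + ∣ encode M ∣ +_) (∣⌈⌉∣ i)) ⟩
    bits (2 + ∣ encode M ∣ + (4 + 5 * length i))
      ≡⟨ cong bits (assoc ∣ encode M ∣ (5 * length i)) ⟩
    bits (6 + ∣ encode M ∣ + 5 * length i)
      ≤⟨ bits-+ (6 + ∣ encode M ∣) (5 * length i) ⟩
    machineBits M + bits (5 * length i)
      ≤⟨ +-monoʳ-≤ (machineBits M) (bits-* 5 (length i)) ⟩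
    machineBits M + suc (5 * bits (length i))
      ≡⟨ cong (machineBits M +_) (arith ⌊log₂ length i ⌋) ⟩
    machineBits M + (6 + 5 * ⌊log₂ length i ⌋) ∎
    where
    open ≤-Reasoning
    assoc : ∀ m k → 2 + m + (4 + k) ≡ 6 + m + k
    assoc = solve-∀
    arith : ∀ l → suc (5 * suc l) ≡ 6 + 5 * l
    arith = solve-∀

  -- At least one cell is always in use, so the factor `S + l` absorbs the constant terms; `slack`
  -- is the exact difference.
  space-≤ : ∀ {S} → 1 ≤ S → 2 ^ expʳ * sizeBound S ≤ spaceConst M * (S + ⌊log₂ length i ⌋)
  space-≤ {suc S} _ = begin
    2 ^ expʳ * sizeBound (suc S)
      ≤⟨ *-monoʳ-≤ (2 ^ expʳ) (+-monoˡ-≤ (suc S * (2 * K)) (+-monoˡ-≤ (6 * K) (*-monoʳ-≤ 2 J≤))) ⟩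
    2 ^ expʳ * (2 * (A + (6 + 5 * l)) + 6 * K + suc S * (2 * K))
      ≤⟨ *-monoʳ-≤ (2 ^ expʳ) (m≤m+n _ slack) ⟩
    2 ^ expʳ * (2 * (A + (6 + 5 * l)) + 6 * K + suc S * (2 * K) + slack)
      ≡⟨ cong (2 ^ expʳ *_) (arith A K l S) ⟩
    2 ^ expʳ * ((2 * A + 22 + 8 * K) * (suc S + l))
      ≡⟨ sym (*-assoc (2 ^ expʳ) (2 * A + 22 + 8 * K) (suc S + l)) ⟩
    spaceConst M * (suc S + l) ∎
    where
    open ≤-Reasoning
    A slack : ℕ
    A = machineBits M
    slack = 10 + 2 * A * (S + l) + 22 * S + 12 * l + 6 * K * S + 8 * K * l
    arith : ∀ A K l S → 2 * (A + (6 + 5 * l)) + 6 * K + suc S * (2 * K) +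
              (10 + 2 * A * (S + l) + 22 * S + 12 * l + 6 * K * S + 8 * K * l) ≡
            (2 * A + 22 + 8 * K) * (suc S + l)
    arith = solve-∀

  loaded-space : ∀ {S} → space (load (encode M · ⌈ i ⌉)) ≤ 2 ^ expʳ * sizeBound S
  loaded-space {S} = begin
    -- The root of the code is the application, whose address is the number that `K` measures.
    K + 0 + 0                     ≡⟨ trans (+-identityʳ _) (+-identityʳ K) ⟩
    K                             ≤⟨ m≤n*m K 6 ⟩
    6 * K                         ≤⟨ m≤n+m (6 * K) (2 * J) ⟩
    2 * J + 6 * K                 ≤⟨ m≤m+n _ (S * (2 * K)) ⟩
    sizeBound S                   ≤⟨ m≤n*m _ (2 ^ expʳ) {{m^n≢0 2 expʳ}} ⟩
    2 ^ expʳ * sizeBound S        ∎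
    where open ≤-Reasoning

  terminates : ∀ b (C : Config M i) → Config.state C ≡ TM.final M b → ∀ (ρ : Run M i C) →
    ∃ λ (σ : Star _→det_ (encode M · ⌈ i ⌉) ⌈ b ⌉ᵇ) →
    IsNormalForm _→det_ ⌈ b ⌉ᵇ ×
    (2 ≤ length i → steps σ ≈Θ[ timeConst M + spaceConst M ]
                    ((T-TM ρ + 1) * length i * ⌊log₂ length i ⌋)) ×
    (∃ λ (s : State) → ∃ λ (κ : Star _→KAM_ (load (encode M · ⌈ i ⌉)) s) →
     IsNormalForm _→KAM_ s ×
     S-KAM κ ≤O[ timeConst M + spaceConst M ] (S-TM ρ + ⌊log₂ length i ⌋))
  terminates b C halted ρ = repackage
    (realize-halting load-→KAM (loaded-space {S-TM ρ}) loaded-rel ⟦loaded⟧ (halting-path b halted ρ))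
    where
    τ c : ℕ
    τ = T-TM ρ
    c = timeConst M + spaceConst M

    ⌈⌉ᵇ-normal : ∀ b → IsNormalForm _→det_ ⌈ b ⌉ᵇ
    ⌈⌉ᵇ-normal true  (_ , ())
    ⌈⌉ᵇ-normal false (_ , ())

    time : ∀ {k} → 6 + τ * suc (l * n) + suc (l * n) ≤ k → k ≤ 6 + τ * hiʳ n l + hiʳ n l → 2 ≤ n →
           k ≈Θ[ c ] ((τ + 1) * n * l)
    time {k} lo hi 2≤n =
      ≤-trans hi (≤-trans (hi-≤ M τ 2≤n (⌊log₂⌋-mono-≤ 2≤n))
                          (*-monoˡ-≤ ((τ + 1) * n * l) (m≤m+n (timeConst M) (spaceConst M)))) ,
      ≤-trans (≤-trans (lo-≤ τ n l) lo) (m≤n*m k c)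

    memory : ∀ {k} → k ≤ 2 ^ expʳ * sizeBound (S-TM ρ) → k ≤O[ c ] (S-TM ρ + l)
    memory k≤ = ≤-trans k≤ (≤-trans (space-≤ (peak≥first ρ))
                                    (*-monoˡ-≤ (S-TM ρ + l) (m≤n+m (spaceConst M) (timeConst M))))

    repackage :
      (∃ λ (σ : Star _→det_ (encode M · ⌈ i ⌉) ⌈ b ⌉ᵇ) →
       (6 + τ * suc (l * n) + suc (l * n) ≤ steps σ × steps σ ≤ 6 + τ * hiʳ n l + hiʳ n l) ×
       (∃ λ s → ∃ λ (κ : Star _→KAM_ (load (encode M · ⌈ i ⌉)) s) →
        IsNormalForm _→KAM_ s × S-KAM κ ≤ 2 ^ expʳ * sizeBound (S-TM ρ))) →
      ∃ λ (σ : Star _→det_ (encode M · ⌈ i ⌉) ⌈ b ⌉ᵇ) →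
      IsNormalForm _→det_ ⌈ b ⌉ᵇ ×
      (2 ≤ n → steps σ ≈Θ[ c ] ((τ + 1) * n * l)) ×
      (∃ λ s → ∃ λ (κ : Star _→KAM_ (load (encode M · ⌈ i ⌉)) s) →
       IsNormalForm _→KAM_ s × S-KAM κ ≤O[ c ] (S-TM ρ + l))
    repackage (σ , (lo , hi) , s , κ , nf , κ≤) =
      σ , ⌈⌉ᵇ-normal b , time lo hi , s , κ , nf , memory κ≤

  diverges : Diverges (_⟶TM_ M i) (initial M i) → Diverges _→det_ (encode M · ⌈ i ⌉)
  diverges (f , f0 , f-steps) = long-runs⇒Diverges λ k →
    long (subst (λ C₀ → ∃[ C ] ∃ λ (ρ : Star (_⟶TM_ M i) C₀ C) → steps ρ ≡ k) f0 (prefix k 0))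
    where
    prefix : ∀ k j → ∃[ C ] ∃ λ (ρ : Star (_⟶TM_ M i) (f j) C) → steps ρ ≡ k
    prefix zero    j = f j , ε , refl
    prefix (suc k) j with prefix k (suc j)
    ... | C , ρ , eq = C , f-steps j ◅ ρ , cong suc eq

    long : ∀ {k} → (∃[ C ] ∃ λ (ρ : Run M i C) → steps ρ ≡ k) →
           ∃[ u ] ∃ λ (σ : Star _→det_ (encode M · ⌈ i ⌉) u) → k ≤ steps σ
    long (C , ρ , refl) = realize-prefix loaded-rel ⟦loaded⟧ (run-path-from-start ρ)
      -- Every transition of the Turing machine contributes at least one β-step.
      (≤-trans (m≤m*n (steps ρ) (suc (⌊log₂ length i ⌋ * length i))) (m≤n+m _ 6))

theorem10p1 : ∃ λ (⌜_⌝ : TM → Term 0) →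
    ∀ (M : TM) →
    Det ⌜ M ⌝ ×
    ∃ λ (c : ℕ) →
    ∀ (i : List Bool) →
    (∀ (b : Bool) (C : Config M i) → Config.state C ≡ TM.final M b →
    ∀ (ρ : Run M i C) →
    ∃ λ (σ : Star _→det_ (⌜ M ⌝ · ⌈ i ⌉) ⌈ b ⌉ᵇ) →
    IsNormalForm _→det_ ⌈ b ⌉ᵇ ×
    (2 ≤ length i →
    steps σ ≈Θ[ c ] ((T-TM ρ + 1) * length i * ⌊log₂ length i ⌋)) ×
    (∃ λ (s : State) →
    ∃ λ (κ : Star _→KAM_ (load (⌜ M ⌝ · ⌈ i ⌉)) s) →
    IsNormalForm _→KAM_ s ×
    S-KAM κ ≤O[ c ] (S-TM ρ + ⌊log₂ length i ⌋)))
    ×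
    (Diverges (_⟶TM_ M i) (initial M i) →
    Diverges _→det_ (⌜ M ⌝ · ⌈ i ⌉))
theorem10p1 = encode , λ M →
  proj₂ (proj₂ (machine M)) , timeConst M + spaceConst M , λ i →
  Input.terminates M i , Input.diverges M i
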